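{- For every $b\ge 5$ and $\delta\in(0,1/8]$, any polynomial $p(x)$ that approximates $e^{ -x}$ uniformly over the interval $[0,b]$ up to an error of $\delta$, i.e., $\sup_{x\in[0,b]}|e^{ -x}-p(x)|\le\delta$, must have degree at least $\frac{1}{3}\sqrt{b}$.
   Context: Polynomials are univariate with real coefficients. -}

module Defs where

open import Data.Nat.Base as ℕ using (ℕ; zero; suc)
import Data.Nat.Properties as ℕ
open import Data.Integer.Base as ℤ using (+_; -[1+_])
import Data.Integer.Properties as ℤ
open import Data.Rational.Base as ℚ using (ℚ; mkℚ; 0ℚ; 1ℚ; ½)
import Data.Rational.Properties as ℚ
import Data.Rational.Unnormalised.Base as ℚᵘ
import Data.Rational.Unnormalised.Properties as ℚᵘ
open import Data.Rational.Solver using (module +-*-Solver)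
open import Data.List.Base using (List; []; _∷_)
open import Data.Product.Base using (∃; _×_; _,_; proj₁; proj₂)
open import Data.Sum.Base using (inj₁; inj₂)
open import Data.Bool.Base using (if_then_else_)
open import Data.Empty using (⊥-elim)
open import Function.Base using (_$_)
open import Relation.Nullary.Decidable.Core using (Dec; yes; no; does)
open import Relation.Binary.PropositionalEquality
  using (_≡_; refl; sym; trans; cong; subst; subst₂)

IsCauchy : (ℕ → ℚ) → Set
IsCauchy u = ∀ ε → 0ℚ ℚ.< ε →
  ∃ λ N → ∀ m n → N ℕ.≤ m → N ℕ.≤ n → ℚ.∣ u m ℚ.- u n ∣ ℚ.≤ ε

nat : ℕ → ℚ
nat n = + n ℚ./ 1

recip : ℕ → ℚ
recip n = + 1 ℚ./ suc n

-- expTerm q k = q^k / k!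
expTerm : ℚ → ℕ → ℚ
expTerm q zero    = 1ℚ
expTerm q (suc k) = expTerm q k ℚ.* (q ℚ.* recip k)

-- expSum q n = Σ_{k ≤ n} q^k / k!
expSum : ℚ → ℕ → ℚ
expSum q zero    = expTerm q zero
expSum q (suc n) = expSum q n ℚ.+ expTerm q (suc n)

climb : ℚ → ℕ → ℕ → ℕ
climb r zero       k = k
climb r (suc fuel) k =
  if does (nat (suc k) ℚ.* nat (suc k) ℚ.≤? r) then climb r fuel (suc k) else k

-- For r ≥ 0, the largest k with k² ≤ r; such a k is at most the numerator of r.
floorSqrt : ℚ → ℕ
floorSqrt r = climb r ℤ.∣ ℚ.↥ r ∣ 0

scaled : ℚ → ℕ → ℚ
scaled q n = (q ℚ.⊔ 0ℚ) ℚ.* (nat (suc n) ℚ.* nat (suc n))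

-- For q ≥ 0, the largest multiple of 1/(n+1) whose square is at most q.
sqrtApprox : ℚ → ℕ → ℚ
sqrtApprox q n = nat (floorSqrt (scaled q n)) ℚ.* recip n

module RationalLemmas where

 open import Data.Rational.Base using (_+_; _*_; _-_; -_; ∣_∣; _≤_; _<_)
 open import Data.Rational.Properties using (module ≤-Reasoning)
 open ≤-Reasoning
 open +-*-Solver

 abstract

  0≤* : ∀ {p q} → 0ℚ ≤ p → 0ℚ ≤ q → 0ℚ ≤ p * q
  0≤* {p} {q} hp hq = ℚ.nonNegative⁻¹ (p * q)
    {{ℚ.nonNeg*nonNeg⇒nonNeg p {{ℚ.nonNegative hp}} q {{ℚ.nonNegative hq}}}}

  0<* : ∀ {p q} → 0ℚ < p → 0ℚ < q → 0ℚ < p * q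
  0<* {p} {q} hp hq = ℚ.positive⁻¹ (p * q)
    {{ℚ.pos*pos⇒pos p {{ℚ.positive hp}} q {{ℚ.positive hq}}}}

  *-mono : ∀ {p q r s} → 0ℚ ≤ q → 0ℚ ≤ r → p ≤ q → r ≤ s → p * r ≤ q * s
  *-mono {q = q} {r = r} 0≤q 0≤r p≤q r≤s = ℚ.≤-trans
    (ℚ.*-monoʳ-≤-nonNeg r {{ℚ.nonNegative 0≤r}} p≤q)
    (ℚ.*-monoˡ-≤-nonNeg q {{ℚ.nonNegative 0≤q}} r≤s)

  ≤-+ : ∀ p {q} → 0ℚ ≤ q → p ≤ p + q
  ≤-+ p {q} h = subst (λ z → z ≤ p + q) (ℚ.+-identityʳ p) (ℚ.+-monoʳ-≤ p h)

  0<½ : 0ℚ < ½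
  0<½ = ℚ.positive⁻¹ ½

  halves : ∀ ε → ½ * ε + ½ * ε ≡ ε
  halves = solve 1 (λ e → con ½ :* e :+ con ½ :* e := e) refl

  ∣-∣-swap : ∀ p q → ∣ p - q ∣ ≡ ∣ q - p ∣
  ∣-∣-swap p q = trans (sym (ℚ.∣-p∣≡∣p∣ (p - q)))
    (cong ∣_∣ (solve 2 (λ a b → :- (a :- b) := b :- a) refl p q))

  ∣-∣≤ : ∀ {p q r} → p ≤ q + r → q ≤ p + r → ∣ p - q ∣ ≤ r
  ∣-∣≤ {p} {q} {r} h₁ h₂ with ℚ.∣p∣≡p∨∣p∣≡-p (p - q)
  ... | inj₁ e = begin
    ∣ p - q ∣   ≡⟨ e ⟩
    p - q       ≤⟨ ℚ.+-monoˡ-≤ (- q) h₁ ⟩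
    q + r - q   ≡⟨ solve 2 (λ q r → q :+ r :- q := r) refl q r ⟩
    r           ∎
  ... | inj₂ e = begin
    ∣ p - q ∣   ≡⟨ e ⟩
    - (p - q)   ≡⟨ solve 2 (λ p q → :- (p :- q) := q :- p) refl p q ⟩
    q - p       ≤⟨ ℚ.+-monoˡ-≤ (- p) h₂ ⟩
    p + r - p   ≡⟨ solve 2 (λ q r → q :+ r :- q := r) refl p r ⟩
    r           ∎

  ≤∣∣ : ∀ p → p ≤ ∣ p ∣
  ≤∣∣ p with ℚ.≤-total 0ℚ p
  ... | inj₁ h = ℚ.≤-reflexive (sym (ℚ.0≤p⇒∣p∣≡p h))
  ... | inj₂ h = ℚ.≤-trans h (ℚ.0≤∣p∣ p)

  ∣-∣≤⁻ : ∀ {p q r} → ∣ p - q ∣ ≤ r → p ≤ q + r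
  ∣-∣≤⁻ {p} {q} {r} h = begin
    p             ≡⟨ solve 2 (λ p q → p := q :+ (p :- q)) refl p q ⟩
    q + (p - q)   ≤⟨ ℚ.+-monoʳ-≤ q (ℚ.≤-trans (≤∣∣ _) h) ⟩
    q + r         ∎

  triangle : ∀ {p q r s t} → ∣ p - q ∣ ≤ s → ∣ q - r ∣ ≤ t → ∣ p - r ∣ ≤ s + t
  triangle {p} {q} {r} {s} {t} h₁ h₂ = begin
    ∣ p - r ∣               ≡⟨ cong ∣_∣ (solve 3 (λ p q r →
                                 p :- r := (p :- q) :+ (q :- r)) refl p q r) ⟩
    ∣ (p - q) + (q - r) ∣   ≤⟨ ℚ.∣p+q∣≤∣p∣+∣q∣ (p - q) (q - r) ⟩
    ∣ p - q ∣ + ∣ q - r ∣   ≤⟨ ℚ.+-mono-≤ h₁ h₂ ⟩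
    s + t                   ∎

  nat-suc : ∀ n → nat (suc n) ≡ 1ℚ + nat n
  nat-suc n = ℚ.toℚᵘ-injective $ ℚᵘ.≃-trans (ℚ.toℚᵘ-fromℚᵘ (ℚᵘ.mkℚᵘ (+ suc n) 0))
    $ ℚᵘ.≃-sym $ ℚᵘ.≃-trans (ℚ.toℚᵘ-homo-+ 1ℚ (nat n))
    $ ℚᵘ.≃-trans (ℚᵘ.+-congʳ (ℚᵘ.mkℚᵘ (+ 1) 0) (ℚ.toℚᵘ-fromℚᵘ (ℚᵘ.mkℚᵘ (+ n) 0)))
    $ ℚᵘ.*≡* (cong (λ z → (+ 1 ℤ.+ z) ℤ.* + 1) (ℤ.*-identityʳ (+ n)))

  nat-≥0 : ∀ n → 0ℚ ≤ nat n
  nat-≥0 n = ℚ.nonNegative⁻¹ (nat n) {{ℚ.normalize-nonNeg n 1}}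

  nat-mono : ∀ {m n} → m ℕ.≤ n → nat m ≤ nat n
  nat-mono {n = n} ℕ.z≤n = nat-≥0 n
  nat-mono (ℕ.s≤s {m} {n} h) =
    subst₂ _≤_ (sym (nat-suc m)) (sym (nat-suc n)) (ℚ.+-monoʳ-≤ 1ℚ (nat-mono h))

  0<recip : ∀ n → 0ℚ < recip n
  0<recip n = ℚ.positive⁻¹ (recip n) {{ℚ.normalize-pos 1 (suc n)}}

  0≤recip : ∀ n → 0ℚ ≤ recip n
  0≤recip n = ℚ.<⇒≤ (0<recip n)

  nat*recip : ∀ n → nat (suc n) * recip n ≡ 1ℚ
  nat*recip n = ℚ.toℚᵘ-injective $ ℚᵘ.≃-trans (ℚ.toℚᵘ-homo-* (nat (suc n)) (recip n))
    $ ℚᵘ.≃-trans (ℚᵘ.*-cong (ℚ.toℚᵘ-fromℚᵘ (ℚᵘ.mkℚᵘ (+ suc n) 0)) (ℚ.toℚᵘ-fromℚᵘ (ℚᵘ.mkℚᵘ (+ 1) n)))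
    $ ℚᵘ.*≡* (cong +_ (trans (ℕ.*-identityʳ _) (trans (ℕ.*-identityʳ _)
        (sym (trans (ℕ.+-identityʳ _) (ℕ.+-identityʳ _))))))

  -- p ≤ q/(n+1) follows from p (n+1) ≤ q
  ≤*recip : ∀ {p q} n → p * nat (suc n) ≤ q → p ≤ q * recip n
  ≤*recip {p} {q} n h = begin
    p                              ≡⟨ sym (ℚ.*-identityʳ p) ⟩
    p * 1ℚ                         ≡⟨ cong (p *_) (sym (nat*recip n)) ⟩
    p * (nat (suc n) * recip n)    ≡⟨ sym (ℚ.*-assoc p _ _) ⟩
    p * nat (suc n) * recip n      ≤⟨ ℚ.*-monoʳ-≤-nonNeg (recip n) {{ℚ.nonNegative (0≤recip n)}} h ⟩
    q * recip n                    ∎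

  recip-anti : ∀ {m n} → m ℕ.≤ n → recip n ≤ recip m
  recip-anti {m} {n} h = begin
    recip n        ≤⟨ ≤*recip m (begin
      recip n * nat (suc m)   ≤⟨ ℚ.*-monoˡ-≤-nonNeg (recip n) {{ℚ.nonNegative (0≤recip n)}} (nat-mono (ℕ.s≤s h)) ⟩
      recip n * nat (suc n)   ≡⟨ ℚ.*-comm (recip n) _ ⟩
      nat (suc n) * recip n   ≡⟨ nat*recip n ⟩
      1ℚ                      ∎) ⟩
    1ℚ * recip m   ≡⟨ ℚ.*-identityˡ _ ⟩
    recip m        ∎

  numerator-bound : ∀ r → r ≤ nat ℤ.∣ ℚ.↥ r ∣
  numerator-bound r@(mkℚ (+ n) d _) = ℚ.toℚᵘ-cancel-≤ $
    ℚᵘ.≤-respʳ-≃ (ℚᵘ.≃-sym (ℚ.toℚᵘ-fromℚᵘ (ℚᵘ.mkℚᵘ (+ n) 0)))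
    (ℚᵘ.*≤* (subst₂ ℤ._≤_ (ℤ.pos-* n 1) (ℤ.pos-* n (suc d))
       (ℤ.+≤+ (ℕ.*-monoʳ-≤ n (ℕ.s≤s ℕ.z≤n)))))
  numerator-bound r@(mkℚ -[1+ n ] d _) = ℚ.≤-trans
    (ℚ.<⇒≤ (ℚ.negative⁻¹ r)) (nat-≥0 (suc n))

  archimedean : ∀ ε → 0ℚ < ε → ∃ λ n → recip n ≤ ε
  archimedean ε@(mkℚ (+ zero) d _) 0<ε with ℚ.positive {ε} 0<ε
  ... | ()
  archimedean (mkℚ (+ suc n) d _) 0<ε = d , ℚ.toℚᵘ-cancel-≤
    (ℚᵘ.≤-respˡ-≃ (ℚᵘ.≃-sym (ℚ.toℚᵘ-fromℚᵘ (ℚᵘ.mkℚᵘ (+ 1) d)))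
    (ℚᵘ.*≤* (ℤ.+≤+ (ℕ.*-monoˡ-≤ (suc d) (ℕ.s≤s (ℕ.z≤n {n}))))))
  archimedean ε@(mkℚ -[1+ n ] d _) 0<ε with ℚ.positive {ε} 0<ε
  ... | ()

  cauchy-const : ∀ q → IsCauchy (λ _ → q)
  cauchy-const q ε 0<ε = 0 , λ _ _ _ _ →
    subst (λ z → ∣ z ∣ ≤ ε) (sym (ℚ.+-inverseʳ q)) (ℚ.<⇒≤ 0<ε)

  cauchy-neg : ∀ {u} → IsCauchy u → IsCauchy (λ n → - u n)
  cauchy-neg {u} cu ε 0<ε = let N , h = cu ε 0<ε in N , λ m n N≤m N≤n → subst (_≤ ε)
    (trans (sym (ℚ.∣-p∣≡∣p∣ (u m - u n)))
      (cong ∣_∣ (solve 2 (λ a b → :- (a :- b) := (:- a) :- (:- b)) refl (u m) (u n))))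
    (h m n N≤m N≤n)

  abs-≤ : ∀ p q {ε} → ∣ p - q ∣ ≤ ε → ∣ p ∣ ≤ ∣ q ∣ + ε
  abs-≤ p q {ε} h = begin
    ∣ p ∣                 ≡⟨ cong ∣_∣ (solve 2 (λ p q → p := q :+ (p :- q)) refl p q) ⟩
    ∣ q + (p - q) ∣       ≤⟨ ℚ.∣p+q∣≤∣p∣+∣q∣ q (p - q) ⟩
    ∣ q ∣ + ∣ p - q ∣     ≤⟨ ℚ.+-monoʳ-≤ ∣ q ∣ h ⟩
    ∣ q ∣ + ε             ∎

  cauchy-abs : ∀ {u} → IsCauchy u → IsCauchy (λ n → ∣ u n ∣)
  cauchy-abs {u} cu ε 0<ε = let N , h = cu ε 0<ε in N , λ m n N≤m N≤n →
    ∣-∣≤ (abs-≤ (u m) (u n) (h m n N≤m N≤n)) (abs-≤ (u n) (u m) (h n m N≤n N≤m))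

  cauchy-+ : ∀ {u v} → IsCauchy u → IsCauchy v → IsCauchy (λ n → u n + v n)
  cauchy-+ {u} {v} cu cv ε 0<ε =
    let M , hu = cu (½ * ε) (0<* 0<½ 0<ε)
        N , hv = cv (½ * ε) (0<* 0<½ 0<ε)
    in M ℕ.⊔ N , λ m n hm hn → begin
      ∣ (u m + v m) - (u n + v n) ∣
        ≡⟨ cong ∣_∣ (rearrange (u m) (v m) (u n) (v n)) ⟩
      ∣ (u m - u n) + (v m - v n) ∣
        ≤⟨ ℚ.∣p+q∣≤∣p∣+∣q∣ (u m - u n) (v m - v n) ⟩
      ∣ u m - u n ∣ + ∣ v m - v n ∣
        ≤⟨ ℚ.+-mono-≤ (hu m n (ℕ.m⊔n≤o⇒m≤o M N hm) (ℕ.m⊔n≤o⇒m≤o M N hn))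
                      (hv m n (ℕ.m⊔n≤o⇒n≤o M N hm) (ℕ.m⊔n≤o⇒n≤o M N hn)) ⟩
      ½ * ε + ½ * ε
        ≡⟨ halves ε ⟩
      ε ∎
    where
    rearrange : ∀ a b c d → (a + b) - (c + d) ≡ (a - c) + (b - d)
    rearrange = solve 4 (λ a b c d → (a :+ b) :- (c :+ d) := (a :- c) :+ (b :- d)) refl

  ∣-∣≤⇒∣∣≤ : ∀ p q {r s} → ∣ p - q ∣ ≤ r → ∣ q ∣ ≤ s → ∣ p ∣ ≤ r + s
  ∣-∣≤⇒∣∣≤ p q {r} {s} h₁ h₂ = begin
    ∣ p ∣               ≡⟨ cong ∣_∣ (solve 2 (λ p q → p := (p :- q) :+ q) refl p q) ⟩
    ∣ (p - q) + q ∣     ≤⟨ ℚ.∣p+q∣≤∣p∣+∣q∣ (p - q) q ⟩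
    ∣ p - q ∣ + ∣ q ∣   ≤⟨ ℚ.+-mono-≤ h₁ h₂ ⟩
    r + s               ∎

  bound : ∀ r → ∃ λ k → r ≤ nat k
  bound r = ℤ.∣ ℚ.↥ r ∣ , numerator-bound r

  bounded : ∀ {u} → IsCauchy u → ∃ λ k → ∃ λ N → ∀ n → N ℕ.≤ n → ∣ u n ∣ ≤ nat (suc k)
  bounded {u} cu =
    let N , h = cu 1ℚ (ℚ.positive⁻¹ 1ℚ)
        k , b = bound ∣ u N ∣
    in k , N , λ n N≤n → subst (λ z → ∣ u n ∣ ≤ z) (sym (nat-suc k))
         (∣-∣≤⇒∣∣≤ (u n) (u N) (h n N N≤n ℕ.≤-refl) b)

  *-recip-cancel : ∀ k e → nat (suc k) * (e * recip k) ≡ e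
  *-recip-cancel k e = trans (rearrange (nat (suc k)) e (recip k))
    (trans (cong (λ z → e * z) (nat*recip k)) (ℚ.*-identityʳ e))
    where
    rearrange : ∀ a e r → a * (e * r) ≡ e * (a * r)
    rearrange = solve 3 (λ a e r → a :* (e :* r) := e :* (a :* r)) refl

  *-small : ∀ k p d {e} → ∣ p ∣ ≤ nat (suc k) → ∣ d ∣ ≤ e * recip k → ∣ p * d ∣ ≤ e
  *-small k p d {e} hp hd = subst₂ _≤_ (sym (ℚ.∣p*q∣≡∣p∣*∣q∣ p d)) (*-recip-cancel k e)
    (*-mono {∣ p ∣} {nat (suc k)} {∣ d ∣} {e * recip k} (nat-≥0 (suc k)) (ℚ.0≤∣p∣ d) hp hd)

  cauchy-* : ∀ {u v} → IsCauchy u → IsCauchy v → IsCauchy (λ n → u n * v n)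
  cauchy-* {u} {v} cu cv ε 0<ε =
    let k , M₁ , ∣u∣≤ = bounded {u} cu
        l , N₁ , ∣v∣≤ = bounded {v} cv
        M₂ , hv = cv (½ * ε * recip k) (0<* (0<* 0<½ 0<ε) (0<recip k))
        N₂ , hu = cu (½ * ε * recip l) (0<* (0<* 0<½ 0<ε) (0<recip l))
        M = M₁ ℕ.⊔ M₂
        N = N₁ ℕ.⊔ N₂
        M≤ : ∀ {n} → M ℕ.⊔ N ℕ.≤ n → M ℕ.≤ n
        M≤ = ℕ.m⊔n≤o⇒m≤o M N
        N≤ : ∀ {n} → M ℕ.⊔ N ℕ.≤ n → N ℕ.≤ n
        N≤ = ℕ.m⊔n≤o⇒n≤o M N
    in M ℕ.⊔ N , λ m n hm hn → begin
      ∣ u m * v m - u n * v n ∣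
        ≡⟨ cong ∣_∣ (rearrange (u m) (v m) (u n) (v n)) ⟩
      ∣ u m * (v m - v n) + v n * (u m - u n) ∣
        ≤⟨ ℚ.∣p+q∣≤∣p∣+∣q∣ (u m * (v m - v n)) (v n * (u m - u n)) ⟩
      ∣ u m * (v m - v n) ∣ + ∣ v n * (u m - u n) ∣
        ≤⟨ ℚ.+-mono-≤
             (*-small k (u m) (v m - v n) {½ * ε} (∣u∣≤ m (ℕ.m⊔n≤o⇒m≤o M₁ M₂ (M≤ hm)))
               (hv m n (ℕ.m⊔n≤o⇒n≤o M₁ M₂ (M≤ hm)) (ℕ.m⊔n≤o⇒n≤o M₁ M₂ (M≤ hn))))
             (*-small l (v n) (u m - u n) {½ * ε} (∣v∣≤ n (ℕ.m⊔n≤o⇒m≤o N₁ N₂ (N≤ hn)))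
               (hu m n (ℕ.m⊔n≤o⇒n≤o N₁ N₂ (N≤ hm)) (ℕ.m⊔n≤o⇒n≤o N₁ N₂ (N≤ hn)))) ⟩
      ½ * ε + ½ * ε
        ≡⟨ halves ε ⟩
      ε ∎
    where
    rearrange : ∀ a b c d → a * b - c * d ≡ a * (b - d) + d * (a - c)
    rearrange = solve 4 (λ a b c d → a :* b :- c :* d := a :* (b :- d) :+ d :* (a :- c)) refl

  cauchy-expTerm : ∀ {u} → IsCauchy u → ∀ k → IsCauchy (λ n → expTerm (u n) k)
  cauchy-expTerm cu zero    = cauchy-const 1ℚ
  cauchy-expTerm {u} cu (suc k) =
    cauchy-* {λ n → expTerm (u n) k} {λ n → u n * recip k} (cauchy-expTerm {u} cu k)
      (cauchy-* {u} {λ _ → recip k} cu (cauchy-const (recip k)))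

  cauchy-expSum : ∀ {u} → IsCauchy u → ∀ k → IsCauchy (λ n → expSum (u n) k)
  cauchy-expSum cu zero    = cauchy-const 1ℚ
  cauchy-expSum {u} cu (suc k) =
    cauchy-+ {λ n → expSum (u n) k} {λ n → expTerm (u n) (suc k)}
      (cauchy-expSum {u} cu k) (cauchy-expTerm {u} cu (suc k))

  recip-abs : ∀ k → ∣ recip k ∣ ≡ recip k
  recip-abs k = ℚ.0≤p⇒∣p∣≡p (0≤recip k)

  expTerm-≥0 : ∀ {q} → 0ℚ ≤ q → ∀ k → 0ℚ ≤ expTerm q k
  expTerm-≥0 h zero    = ℚ.nonNegative⁻¹ 1ℚ
  expTerm-≥0 h (suc k) = 0≤* (expTerm-≥0 h k) (0≤* h (0≤recip k))

  expTerm-suc-abs : ∀ q k → ∣ expTerm q (suc k) ∣ ≡ ∣ expTerm q k ∣ * (∣ q ∣ * recip k)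
  expTerm-suc-abs q k = trans (ℚ.∣p*q∣≡∣p∣*∣q∣ (expTerm q k) _)
    (cong (∣ expTerm q k ∣ *_) (trans (ℚ.∣p*q∣≡∣p∣*∣q∣ q (recip k)) (cong (∣ q ∣ *_) (recip-abs k))))

  expTerm-mono : ∀ {q K} → ∣ q ∣ ≤ K → ∀ k → ∣ expTerm q k ∣ ≤ expTerm K k
  expTerm-mono h zero = ℚ.≤-refl
  expTerm-mono {q} {K} h (suc k) = subst (λ z → z ≤ expTerm K k * (K * recip k))
    (sym (expTerm-suc-abs q k))
    (*-mono {∣ expTerm q k ∣} {expTerm K k} {∣ q ∣ * recip k} {K * recip k}
      (expTerm-≥0 (ℚ.≤-trans (ℚ.0≤∣p∣ q) h) k)
      (0≤* (ℚ.0≤∣p∣ q) (0≤recip k)) (expTerm-mono h k)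
      (ℚ.*-monoʳ-≤-nonNeg (recip k) {{ℚ.nonNegative (0≤recip k)}} h))

  -- Beyond index 2K the terms at least halve at each step.
  ratio : ∀ {q} K → ∣ q ∣ ≤ K → ∀ M → K + K ≤ nat M → ∀ i → M ℕ.≤ i → ∣ q ∣ * recip i ≤ ½
  ratio {q} K ∣q∣≤K M 2K≤M i M≤i = begin
    ∣ q ∣ * recip i               ≤⟨ ℚ.*-monoʳ-≤-nonNeg (recip i) {{ℚ.nonNegative (0≤recip i)}} bound′ ⟩
    nat (suc i) * ½ * recip i     ≡⟨ ℚ.*-assoc (nat (suc i)) ½ (recip i) ⟩
    nat (suc i) * (½ * recip i)   ≡⟨ *-recip-cancel i ½ ⟩
    ½                             ∎
    where
    double : ∀ K → K ≡ (K + K) * ½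
    double = solve 1 (λ K → K := (K :+ K) :* con ½) refl
    bound′ : ∣ q ∣ ≤ nat (suc i) * ½
    bound′ = ℚ.≤-trans ∣q∣≤K (subst (λ z → z ≤ nat (suc i) * ½) (sym (double K))
      (ℚ.*-monoʳ-≤-nonNeg ½ (ℚ.≤-trans 2K≤M (nat-mono (ℕ.≤-trans M≤i (ℕ.n≤1+n i))))))

  halving : ∀ {q} K → ∣ q ∣ ≤ K → ∀ M → K + K ≤ nat M → ∀ i → M ℕ.≤ i →
            ∣ expTerm q (suc i) ∣ ≤ ∣ expTerm q i ∣ * ½
  halving {q} K ∣q∣≤K M 2K≤M i M≤i = subst (λ z → z ≤ ∣ expTerm q i ∣ * ½)
    (sym (expTerm-suc-abs q i))
    (ℚ.*-monoˡ-≤-nonNeg ∣ expTerm q i ∣ {{ℚ.nonNegative (ℚ.0≤∣p∣ (expTerm q i))}}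
      (ratio {q} K ∣q∣≤K M 2K≤M i M≤i))

  recip-halving : ∀ j → recip j * ½ ≤ recip (suc j)
  recip-halving j = subst (λ z → recip j * ½ ≤ z) (ℚ.*-identityˡ (recip (suc j)))
    (≤*recip {recip j * ½} {1ℚ} (suc j) (begin
      recip j * ½ * nat (suc (suc j))            ≡⟨ cong (λ z → recip j * ½ * z) (nat-suc (suc j)) ⟩
      recip j * ½ * (1ℚ + nat (suc j))           ≤⟨ ℚ.*-monoˡ-≤-nonNeg (recip j * ½)
                                                      {{ℚ.nonNegative (0≤* (0≤recip j) (ℚ.<⇒≤ 0<½))}}
                                                      (ℚ.+-monoˡ-≤ (nat (suc j)) (nat-mono (ℕ.s≤s (ℕ.z≤n {j})))) ⟩
      recip j * ½ * (nat (suc j) + nat (suc j))  ≡⟨ rearrange (recip j) (nat (suc j)) ⟩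
      nat (suc j) * recip j                      ≡⟨ nat*recip j ⟩
      1ℚ                                         ∎))
    where
    rearrange : ∀ r n → r * ½ * (n + n) ≡ n * r
    rearrange = solve 2 (λ r n → r :* con ½ :* (n :+ n) := n :* r) refl

  decay : ∀ {q} K → ∣ q ∣ ≤ K → ∀ M → K + K ≤ nat M → ∀ j →
          ∣ expTerm q (j ℕ.+ M) ∣ ≤ expTerm K M * recip j
  decay {q} K ∣q∣≤K M 2K≤M zero = subst (λ z → ∣ expTerm q M ∣ ≤ z)
    (sym (ℚ.*-identityʳ (expTerm K M))) (expTerm-mono {q} ∣q∣≤K M)
  decay {q} K ∣q∣≤K M 2K≤M (suc j) = begin
    ∣ expTerm q (suc j ℕ.+ M) ∣   ≤⟨ halving {q} K ∣q∣≤K M 2K≤M (j ℕ.+ M) (ℕ.m≤n+m M j) ⟩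
    ∣ expTerm q (j ℕ.+ M) ∣ * ½   ≤⟨ ℚ.*-monoʳ-≤-nonNeg ½ (decay {q} K ∣q∣≤K M 2K≤M j) ⟩
    expTerm K M * recip j * ½     ≡⟨ ℚ.*-assoc (expTerm K M) (recip j) ½ ⟩
    expTerm K M * (recip j * ½)   ≤⟨ ℚ.*-monoˡ-≤-nonNeg (expTerm K M)
                                       {{ℚ.nonNegative (expTerm-≥0 (ℚ.≤-trans (ℚ.0≤∣p∣ q) ∣q∣≤K) M)}}
                                       (recip-halving j) ⟩
    expTerm K M * recip (suc j)   ∎

  tail-step : ∀ S S₀ T T₀ → ∣ T ∣ ≤ ∣ T₀ ∣ * ½ → ∣ S + T - S₀ ∣ + ∣ T ∣ ≤ ∣ S - S₀ ∣ + ∣ T₀ ∣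
  tail-step S S₀ T T₀ half = begin
    ∣ S + T - S₀ ∣ + ∣ T ∣                   ≡⟨ cong (λ z → ∣ z ∣ + ∣ T ∣) (rearrange S T S₀) ⟩
    ∣ (S - S₀) + T ∣ + ∣ T ∣                 ≤⟨ ℚ.+-monoˡ-≤ ∣ T ∣ (ℚ.∣p+q∣≤∣p∣+∣q∣ (S - S₀) T) ⟩
    ∣ S - S₀ ∣ + ∣ T ∣ + ∣ T ∣               ≡⟨ ℚ.+-assoc (∣ S - S₀ ∣) (∣ T ∣) (∣ T ∣) ⟩
    ∣ S - S₀ ∣ + (∣ T ∣ + ∣ T ∣)             ≤⟨ ℚ.+-monoʳ-≤ ∣ S - S₀ ∣ (ℚ.+-mono-≤ half half) ⟩
    ∣ S - S₀ ∣ + (∣ T₀ ∣ * ½ + ∣ T₀ ∣ * ½)   ≡⟨ cong (λ z → ∣ S - S₀ ∣ + z) (whole ∣ T₀ ∣) ⟩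
    ∣ S - S₀ ∣ + ∣ T₀ ∣                      ∎
    where
    rearrange : ∀ S T S₀ → S + T - S₀ ≡ (S - S₀) + T
    rearrange = solve 3 (λ S T S₀ → S :+ T :- S₀ := (S :- S₀) :+ T) refl
    whole : ∀ a → a * ½ + a * ½ ≡ a
    whole = solve 1 (λ a → a :* con ½ :+ a :* con ½ := a) refl

  tail : ∀ {q} K → ∣ q ∣ ≤ K → ∀ M → K + K ≤ nat M → ∀ L → M ℕ.≤ L → ∀ i →
         ∣ expSum q (i ℕ.+ L) - expSum q L ∣ + ∣ expTerm q (i ℕ.+ L) ∣ ≤ ∣ expTerm q L ∣
  tail {q} K ∣q∣≤K M 2K≤M L M≤L zero = ℚ.≤-reflexive (trans
    (cong (λ z → ∣ z ∣ + ∣ expTerm q L ∣) (ℚ.+-inverseʳ (expSum q L)))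
    (ℚ.+-identityˡ (∣ expTerm q L ∣)))
  tail {q} K ∣q∣≤K M 2K≤M L M≤L (suc i) = ℚ.≤-trans
    (tail-step (expSum q (i ℕ.+ L)) (expSum q L) (expTerm q (suc i ℕ.+ L)) (expTerm q (i ℕ.+ L))
      (halving {q} K ∣q∣≤K M 2K≤M (i ℕ.+ L) (ℕ.≤-trans M≤L (ℕ.m≤n+m L i))))
    (tail {q} K ∣q∣≤K M 2K≤M L M≤L i)

  remainder : ∀ {q} K → ∣ q ∣ ≤ K → ∀ M → K + K ≤ nat M → ∀ j n → j ℕ.+ M ℕ.≤ n →
              ∣ expSum q n - expSum q (j ℕ.+ M) ∣ ≤ expTerm K M * recip j
  remainder {q} K ∣q∣≤K M 2K≤M j n L≤n = begin
    ∣ expSum q n - expSum q L ∣                     ≤⟨ ≤-+ ∣ expSum q n - expSum q L ∣ (ℚ.0≤∣p∣ (expTerm q n)) ⟩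
    ∣ expSum q n - expSum q L ∣ + ∣ expTerm q n ∣   ≤⟨ subst (λ m → ∣ expSum q m - expSum q L ∣ + ∣ expTerm q m ∣ ≤ ∣ expTerm q L ∣)
                                                         (ℕ.m∸n+n≡m L≤n)
                                                         (tail {q} K ∣q∣≤K M 2K≤M L (ℕ.m≤n+m M j) (n ℕ.∸ L)) ⟩
    ∣ expTerm q L ∣                                 ≤⟨ decay {q} K ∣q∣≤K M 2K≤M j ⟩
    expTerm K M * recip j                           ∎
    where
    L : ℕ
    L = j ℕ.+ M

  scale-small : ∀ B e → 0ℚ < e → ∃ λ j → B * recip j ≤ e
  scale-small B e 0<e =
    let c , B≤c = bound B
        j , h = archimedean (e * recip c) (0<* 0<e (0<recip c))
    in j , subst (λ z → B * recip j ≤ z) (*-recip-cancel c e)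
         (*-mono {B} {nat (suc c)} {recip j} {e * recip c} (nat-≥0 (suc c)) (0≤recip j)
           (ℚ.≤-trans B≤c (nat-mono (ℕ.n≤1+n c))) h)

  remainder-small : ∀ K e → 0ℚ < e → ∃ λ L → ∀ q → ∣ q ∣ ≤ K → ∀ n → L ℕ.≤ n →
                    ∣ expSum q n - expSum q L ∣ ≤ e
  remainder-small K e 0<e =
    let M , 2K≤M = bound (K + K)
        j , small = scale-small (expTerm K M) e 0<e
    in j ℕ.+ M , λ q ∣q∣≤K n L≤n →
         ℚ.≤-trans (remainder {q} K ∣q∣≤K M 2K≤M j n L≤n) small

  cauchy-exp : ∀ {u} → IsCauchy u → IsCauchy (λ n → expSum (u n) n)
  cauchy-exp {u} cu ε 0<ε =
    let k , N₀ , ∣u∣≤K = bounded {u} cu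
        L , small = remainder-small (nat (suc k)) (½ * (½ * ε)) (0<* 0<½ (0<* 0<½ 0<ε))
        N₁ , close = cauchy-expSum {u} cu L (½ * ε) (0<* 0<½ 0<ε)
        N = L ℕ.⊔ N₁
        N₁≤ : ∀ {n} → N₀ ℕ.⊔ N ℕ.≤ n → N₁ ℕ.≤ n
        N₁≤ h = ℕ.m⊔n≤o⇒n≤o L N₁ (ℕ.m⊔n≤o⇒n≤o N₀ N h)
        approx : ∀ n → N₀ ℕ.⊔ N ℕ.≤ n → ∣ expSum (u n) n - expSum (u n) L ∣ ≤ ½ * (½ * ε)
        approx n h = small (u n) (∣u∣≤K n (ℕ.m⊔n≤o⇒m≤o N₀ N h)) n
          (ℕ.m⊔n≤o⇒m≤o L N₁ (ℕ.m⊔n≤o⇒n≤o N₀ N h))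
    in N₀ ℕ.⊔ N , λ m n hm hn →
      subst (λ z → ∣ expSum (u m) m - expSum (u n) n ∣ ≤ z) (quarters ε)
        (triangle {expSum (u m) m} {expSum (u n) L} {expSum (u n) n}
          (triangle {expSum (u m) m} {expSum (u m) L} {expSum (u n) L}
            (approx m hm) (close m n (N₁≤ hm) (N₁≤ hn)))
          (subst (λ z → z ≤ ½ * (½ * ε)) (∣-∣-swap (expSum (u n) n) (expSum (u n) L))
            (approx n hn)))
    where
    quarters : ∀ ε → ½ * (½ * ε) + ½ * ε + ½ * (½ * ε) ≡ ε
    quarters = solve 1 (λ e → con ½ :* (con ½ :* e) :+ con ½ :* e :+ con ½ :* (con ½ :* e) := e) refl

  climb-lower : ∀ r fuel k → nat k * nat k ≤ r → nat (climb r fuel k) * nat (climb r fuel k) ≤ r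
  climb-lower r zero       k h = h
  climb-lower r (suc fuel) k h = step (nat (suc k) * nat (suc k) ℚ.≤? r)
    where
    step : (d : Dec (nat (suc k) * nat (suc k) ≤ r)) →
           let j = if does d then climb r fuel (suc k) else k in nat j * nat j ≤ r
    step (yes h′) = climb-lower r fuel (suc k) h′
    step (no  _)  = h

  nat-square : ∀ k → nat k < nat (suc k) * nat (suc k)
  nat-square k = begin-strict
    nat k                         ≡⟨ sym (ℚ.+-identityˡ (nat k)) ⟩
    0ℚ + nat k                    <⟨ ℚ.+-monoˡ-< (nat k) (ℚ.positive⁻¹ 1ℚ) ⟩
    1ℚ + nat k                    ≡⟨ sym (nat-suc k) ⟩
    nat (suc k)                   ≡⟨ sym (ℚ.*-identityˡ (nat (suc k))) ⟩
    1ℚ * nat (suc k)              ≤⟨ ℚ.*-monoʳ-≤-nonNeg (nat (suc k)) {{ℚ.nonNegative (nat-≥0 (suc k))}}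
                                       (nat-mono (ℕ.s≤s (ℕ.z≤n {k}))) ⟩
    nat (suc k) * nat (suc k)     ∎

  climb-upper : ∀ r fuel k → r ≤ nat (fuel ℕ.+ k) →
                r < nat (suc (climb r fuel k)) * nat (suc (climb r fuel k))
  climb-upper r zero       k h = ℚ.≤-<-trans h (nat-square k)
  climb-upper r (suc fuel) k h = step (nat (suc k) * nat (suc k) ℚ.≤? r)
    where
    step : (d : Dec (nat (suc k) * nat (suc k) ≤ r)) →
           let j = suc (if does d then climb r fuel (suc k) else k) in r < nat j * nat j
    step (yes _)  = climb-upper r fuel (suc k) (subst (λ n → r ≤ nat n) (sym (ℕ.+-suc fuel k)) h)
    step (no  h′) = ℚ.≰⇒> h′

  floorSqrt-lower : ∀ r → 0ℚ ≤ r → nat (floorSqrt r) * nat (floorSqrt r) ≤ r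
  floorSqrt-lower r 0≤r = climb-lower r ℤ.∣ ℚ.↥ r ∣ 0 0≤r

  floorSqrt-upper : ∀ r → r < nat (suc (floorSqrt r)) * nat (suc (floorSqrt r))
  floorSqrt-upper r = climb-upper r ℤ.∣ ℚ.↥ r ∣ 0
    (subst (λ m → r ≤ nat m) (sym (ℕ.+-identityʳ ℤ.∣ ℚ.↥ r ∣)) (numerator-bound r))

  0≤⊔ : ∀ q → 0ℚ ≤ q ℚ.⊔ 0ℚ
  0≤⊔ q = ℚ.p≤q⊔p q 0ℚ

  sqrtApprox-≥0 : ∀ q n → 0ℚ ≤ sqrtApprox q n
  sqrtApprox-≥0 q n = 0≤* (nat-≥0 (floorSqrt (scaled q n))) (0≤recip n)

  cancel-square : ∀ a n → a * (nat (suc n) * nat (suc n)) * (recip n * recip n) ≡ a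
  cancel-square a n = trans (rearrange a (nat (suc n)) (recip n))
    (trans (cong (λ z → a * (z * z)) (nat*recip n)) (ℚ.*-identityʳ a))
    where
    rearrange : ∀ a s r → a * (s * s) * (r * r) ≡ a * ((s * r) * (s * r))
    rearrange = solve 3 (λ a s r → a :* (s :* s) :* (r :* r) := a :* ((s :* r) :* (s :* r))) refl

  scaled-≥0 : ∀ q n → 0ℚ ≤ scaled q n
  scaled-≥0 q n = 0≤* (0≤⊔ q) (0≤* (nat-≥0 (suc n)) (nat-≥0 (suc n)))

  square-lower : ∀ {a b} k n → nat k * nat k ≤ b → b * (recip n * recip n) ≡ a →
                 (nat k * recip n) * (nat k * recip n) ≤ a
  square-lower {a} {b} k n h e = subst₂ _≤_ (sym (rearrange (nat k) (recip n))) e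
    (ℚ.*-monoʳ-≤-nonNeg (recip n * recip n) {{ℚ.nonNegative (0≤* (0≤recip n) (0≤recip n))}} h)
    where
    rearrange : ∀ k r → (k * r) * (k * r) ≡ (k * k) * (r * r)
    rearrange = solve 2 (λ k r → (k :* r) :* (k :* r) := (k :* k) :* (r :* r)) refl

  square-upper : ∀ {a b} k n → b < nat (suc k) * nat (suc k) → b * (recip n * recip n) ≡ a →
                 a < (nat k * recip n + recip n) * (nat k * recip n + recip n)
  square-upper {a} {b} k n h e = subst₂ _<_ e
    (trans (cong (λ z → z * z * (recip n * recip n)) (nat-suc k)) (rearrange (nat k) (recip n)))
    (ℚ.*-monoˡ-<-pos (recip n * recip n) {{ℚ.positive (0<* (0<recip n) (0<recip n))}} h)
    where
    rearrange : ∀ k r → ((1ℚ + k) * (1ℚ + k)) * (r * r) ≡ (k * r + r) * (k * r + r)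
    rearrange = solve 2 (λ k r → ((con 1ℚ :+ k) :* (con 1ℚ :+ k)) :* (r :* r)
                               := (k :* r :+ r) :* (k :* r :+ r)) refl

  sqrtApprox-lower : ∀ q n → sqrtApprox q n * sqrtApprox q n ≤ q ℚ.⊔ 0ℚ
  sqrtApprox-lower q n = square-lower (floorSqrt (scaled q n)) n
    (floorSqrt-lower (scaled q n) (scaled-≥0 q n)) (cancel-square (q ℚ.⊔ 0ℚ) n)

  sqrtApprox-upper : ∀ q n → q ℚ.⊔ 0ℚ < (sqrtApprox q n + recip n) * (sqrtApprox q n + recip n)
  sqrtApprox-upper q n = square-upper (floorSqrt (scaled q n)) n
    (floorSqrt-upper (scaled q n)) (cancel-square (q ℚ.⊔ 0ℚ) n)

  -- a² ≤ c + e² and c ≤ b² imply a ≤ b + e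
  root-step : ∀ {a b c e} → 0ℚ ≤ b → 0ℚ ≤ e → a * a ≤ c + e * e → c ≤ b * b → a ≤ b + e
  root-step {a} {b} {c} {e} 0≤b 0≤e h₁ h₂ = decide (a ℚ.≤? b + e)
    where
    0≤b+e : 0ℚ ≤ b + e
    0≤b+e = ℚ.+-mono-≤ 0≤b 0≤e
    rearrange : ∀ b e → b * b + e * e + (b * e + b * e) ≡ (b + e) * (b + e)
    rearrange = solve 2 (λ b e → b :* b :+ e :* e :+ (b :* e :+ b :* e) := (b :+ e) :* (b :+ e)) refl
    decide : Dec (a ≤ b + e) → a ≤ b + e
    decide (yes h) = h
    decide (no  h) = ⊥-elim (ℚ.<-irrefl refl (begin-strict
      (b + e) * (b + e)   ≤⟨ ℚ.*-monoˡ-≤-nonNeg (b + e) {{ℚ.nonNegative 0≤b+e}} (ℚ.<⇒≤ (ℚ.≰⇒> h)) ⟩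
      (b + e) * a         <⟨ ℚ.*-monoˡ-<-pos a {{ℚ.positive (ℚ.≤-<-trans 0≤b+e (ℚ.≰⇒> h))}} (ℚ.≰⇒> h) ⟩
      a * a               ≤⟨ h₁ ⟩
      c + e * e           ≤⟨ ℚ.+-monoˡ-≤ (e * e) h₂ ⟩
      b * b + e * e       ≤⟨ ≤-+ (b * b + e * e) (ℚ.+-mono-≤ (0≤* 0≤b 0≤e) (0≤* 0≤b 0≤e)) ⟩
      b * b + e * e + (b * e + b * e)
                          ≡⟨ rearrange b e ⟩
      (b + e) * (b + e)   ∎))

  sqrtApprox-close : ∀ {p q e} → 0ℚ < e → ∣ p - q ∣ ≤ e * e → ∀ m n →
                     sqrtApprox p m ≤ sqrtApprox q n + recip n + e
  sqrtApprox-close {p} {q} {e} 0<e h m n = root-step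
    {sqrtApprox p m} {sqrtApprox q n + recip n} {q ℚ.⊔ 0ℚ} {e}
    (ℚ.+-mono-≤ (sqrtApprox-≥0 q n) (0≤recip n)) (ℚ.<⇒≤ 0<e)
    (ℚ.≤-trans (sqrtApprox-lower p m) (ℚ.⊔-lub p≤ 0≤))
    (ℚ.<⇒≤ (sqrtApprox-upper q n))
    where
    0≤e*e : 0ℚ ≤ e * e
    0≤e*e = ℚ.<⇒≤ (0<* 0<e 0<e)
    p≤ : p ≤ q ℚ.⊔ 0ℚ + e * e
    p≤ = ℚ.≤-trans (∣-∣≤⁻ h) (ℚ.+-monoˡ-≤ (e * e) (ℚ.p≤p⊔q q 0ℚ))
    0≤ : 0ℚ ≤ q ℚ.⊔ 0ℚ + e * e
    0≤ = ℚ.+-mono-≤ (0≤⊔ q) 0≤e*e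

  cauchy-sqrt : ∀ {u} → IsCauchy u → IsCauchy (λ n → sqrtApprox (u n) n)
  cauchy-sqrt {u} cu ε 0<ε =
    let 0<e = 0<* 0<½ 0<ε
        A , small = archimedean (½ * ε) 0<e
        B , close = cu ((½ * ε) * (½ * ε)) (0<* 0<e 0<e)
        below : ∀ m n → A ℕ.⊔ B ℕ.≤ m → A ℕ.⊔ B ℕ.≤ n →
                sqrtApprox (u m) m ≤ sqrtApprox (u n) n + ε
        below = λ m n hm hn → ℚ.≤-trans
          (sqrtApprox-close {u m} {u n} {½ * ε} 0<e
             (close m n (ℕ.m⊔n≤o⇒n≤o A B hm) (ℕ.m⊔n≤o⇒n≤o A B hn)) m n)
          (absorb (sqrtApprox (u n) n) (recip n)
             (ℚ.≤-trans (recip-anti (ℕ.m⊔n≤o⇒m≤o A B hn)) small))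
    in A ℕ.⊔ B , λ m n hm hn →
         ∣-∣≤ {sqrtApprox (u m) m} {sqrtApprox (u n) n} (below m n hm hn) (below n m hn hm)
    where
    absorb : ∀ s r → r ≤ ½ * ε → s + r + ½ * ε ≤ s + ε
    absorb s r h = subst (λ z → s + r + ½ * ε ≤ z)
      (trans (ℚ.+-assoc s (½ * ε) (½ * ε)) (cong (λ z → s + z) (halves ε)))
      (ℚ.+-monoˡ-≤ (½ * ε) (ℚ.+-monoʳ-≤ s h))

open RationalLemmas

infix  4 _≃_ _≤_ _<_
infixl 6 _+_ _-_
infixl 7 _*_
infix  8 -_

-- Equality of reals is _≃_, not _≡_.
record ℝ : Set where
  constructor mkℝ
  field
    seq    : ℕ → ℚ
    cauchy : IsCauchy seq

open ℝ public

record _≃_ (x y : ℝ) : Set where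
  constructor mk≃
  field
    close : ∀ ε → 0ℚ ℚ.< ε →
      ∃ λ N → ∀ n → N ℕ.≤ n → ℚ.∣ seq x n ℚ.- seq y n ∣ ℚ.≤ ε

record _≤_ (x y : ℝ) : Set where
  constructor mk≤
  field
    below : ∀ ε → 0ℚ ℚ.< ε →
      ∃ λ N → ∀ n → N ℕ.≤ n → seq x n ℚ.≤ seq y n ℚ.+ ε

record _<_ (x y : ℝ) : Set where
  constructor mk<
  field
    separated : ∃ λ ε → 0ℚ ℚ.< ε ×
      ∃ λ N → ∀ n → N ℕ.≤ n → seq x n ℚ.+ ε ℚ.≤ seq y n

fromℚ : ℚ → ℝ
fromℚ q = mkℝ (λ _ → q) (cauchy-const q)

fromℕ : ℕ → ℝ
fromℕ n = fromℚ (nat n)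

0ℝ : ℝ
0ℝ = fromℕ 0

_+_ _*_ : ℝ → ℝ → ℝ
x + y = mkℝ (λ n → seq x n ℚ.+ seq y n) (cauchy-+ {seq x} {seq y} (cauchy x) (cauchy y))
x * y = mkℝ (λ n → seq x n ℚ.* seq y n) (cauchy-* {seq x} {seq y} (cauchy x) (cauchy y))

-_ : ℝ → ℝ
- x = mkℝ (λ n → ℚ.- seq x n) (cauchy-neg {seq x} (cauchy x))

_-_ : ℝ → ℝ → ℝ
x - y = x + (- y)

∣_∣ : ℝ → ℝ
∣ x ∣ = mkℝ (λ n → ℚ.∣ seq x n ∣) (cauchy-abs {seq x} (cauchy x))

exp : ℝ → ℝ
exp x = mkℝ (λ n → expSum (seq x n) n) (cauchy-exp {seq x} (cauchy x))

-- Negative arguments are sent to 0.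
√ : ℝ → ℝ
√ x = mkℝ (λ n → sqrtApprox (seq x n) n) (cauchy-sqrt {seq x} (cauchy x))

-- a₀ ∷ a₁ ∷ … is a₀ + a₁x + …; trailing coefficients may vanish.
Polynomial : Set
Polynomial = List ℝ

eval : Polynomial → ℝ → ℝ
eval []      x = 0ℝ
eval (a ∷ p) x = a + x * eval p x

coeff : Polynomial → ℕ → ℝ
coeff []      k       = 0ℝ
coeff (a ∷ p) zero    = a
coeff (a ∷ p) (suc k) = coeff p k

DegreeAtMost : Polynomial → ℕ → Set
DegreeAtMost p d = ∀ k → d ℕ.< k → coeff p k ≃ 0ℝ

-- The degree is the least d with DegreeAtMost p d; it cannot be computed, as
-- vanishing of a real is undecidable, so lower bounds on it are lower bounds
-- on all such d.
DegreeAtLeast : Polynomial → ℝ → Set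
DegreeAtLeast p r = ∀ d → DegreeAtMost p d → r ≤ fromℕ d

-- sup_{x ∈ [a,b]} |f x - g x| ≤ δ
UniformlyApproximates : (f g : ℝ → ℝ) (a b δ : ℝ) → Set
UniformlyApproximates f g a b δ = ∀ x → a ≤ x → x ≤ b → ∣ f x - g x ∣ ≤ δ

{-# OPTIONS --safe #-}

-- Put ρᵢ = (−1)ⁱ (n!)² / ((n − i)! (n + i)!).  The functional f ↦ f(0) + 2 Σ_{1 ≤ i ≤ n} ρᵢ f(i)
-- annihilates polynomials of degree < n in i²: it annihilates 1 because the partial sums
-- telescope, and multiplying f by n² − i² gives n² times the functional for n − 1.
-- If deg p ≤ d, apply it with n = d to (p(x) − p(1)) / (x − 1) at the nodes x = 9i².  Since
-- |ρᵢ| ≤ 1 and Σ 1/(9i² − 1) ≤ 2/9, this gives p(0) − p(1) ≤ 4/9 · max |p(9i²) − p(1)|.  When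
-- 9d² ≤ b all nodes lie in [0,b], and then 0 ≤ e⁻ˣ ≤ 3/8 for x ≥ 1 makes the left side at
-- least 3/8 but the right side at most 4/9 · 5/8.
-- The bounds on e⁻ˣ follow from e ≥ 8/3 and eˣ e⁻ˣ = 1, that is, from the Cauchy product.
module Submission where

open import Defs using (nat; recip; expTerm; expSum; sqrtApprox; module RationalLemmas)
open import Data.Nat.Base as ℕ using (ℕ; zero; suc)
import Data.Nat.Properties as ℕ
open import Data.Rational.Base as ℚ using (ℚ; 0ℚ; 1ℚ; ½)
import Data.Rational.Properties as ℚ
open import Data.Rational.Solver using (module +-*-Solver)
open import Data.List.Base using (List; []; _∷_; length; map; take)
open import Data.List.Properties using (length-take)
open import Data.Product.Base using (∃; _×_; _,_; proj₁; proj₂)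
open import Data.Sum.Base using (_⊎_; inj₁; inj₂)
open import Data.Empty using (⊥; ⊥-elim)
open import Function.Base using (_∘_)
open import Relation.Nullary.Decidable.Core using (Dec; yes; no)
open import Relation.Binary.PropositionalEquality
  using (_≡_; refl; sym; trans; cong; cong₂; subst; subst₂)

open RationalLemmas

module RationalArguments where

 import Data.Integer.Base as ℤ
 open import Data.Rational.Base using (_/_; _+_; _*_; _-_; -_; ∣_∣; _≤_; _<_)
 open import Data.Rational.Properties using (module ≤-Reasoning)
 open ≤-Reasoning
 open +-*-Solver

 -- Weights and the functional annihilating polynomials in i².

 evalℚ : List ℚ → ℚ → ℚ
 evalℚ []      x = 0ℚ
 evalℚ (a ∷ p) x = a + x * evalℚ p x

 -- weight n i = (−1)ⁱ (n!)² / ((n − i)! (n + i)!), which is 0 for i > n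
 weight : ℕ → ℕ → ℚ
 weight n zero    = 1ℚ
 weight n (suc i) = - (weight n i * ((nat n - nat i) * recip (n ℕ.+ i)))

 -- altSum n k f = f(0) + 2 Σ_{1 ≤ i ≤ k} weight n i · f(i)
 altSum : ℕ → ℕ → (ℕ → ℚ) → ℚ
 altSum n zero    f = f 0
 altSum n (suc k) f = altSum n k f + (weight n (suc k) * f (suc k) + weight n (suc k) * f (suc k))

 -- Synthetic division: the coefficients of (p(x) - p(c)) / (x - c) are the values at c of the
 -- proper tails of p.
 quotient : ℚ → List ℚ → List ℚ
 quotient c []          = []
 quotient c (a ∷ [])    = []
 quotient c (a ∷ b ∷ p) = evalℚ (b ∷ p) c ∷ quotient c (b ∷ p)

 -- With d ≤ √b/3 the nodes 9i², i ≤ d, lie in [0,b].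
 node : ℕ → ℚ
 node i = nat 9 * (nat i * nat i)

 abstract

  -- Turns an inequality into a ring identity for the solver: the difference is displayed as a
  -- visibly nonnegative term.
  ≤-diff : ∀ {p q r} → 0ℚ ≤ r → q - p ≡ r → p ≤ q
  ≤-diff {p} {q} {r} h e = begin
    p             ≤⟨ ≤-+ p (subst (0ℚ ≤_) (sym e) h) ⟩
    p + (q - p)   ≡⟨ solve 2 (λ p q → p :+ (q :- p) := q) refl p q ⟩
    q             ∎

  0≤- : ∀ {p q} → p ≤ q → 0ℚ ≤ q - p
  0≤- {p} {q} h = subst (_≤ q - p) (ℚ.+-inverseʳ p) (ℚ.+-monoˡ-≤ (- p) h)

  +-cancelʳ-≤ : ∀ r {p q} → p + r ≤ q + r → p ≤ q
  +-cancelʳ-≤ r {p} {q} h = ≤-diff (0≤- h)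
    (solve 3 (λ p q r → q :- p := (q :+ r) :- (p :+ r)) refl p q r)

  nat-+ : ∀ m n → nat (m ℕ.+ n) ≡ nat m + nat n
  nat-+ zero    n = sym (ℚ.+-identityˡ (nat n))
  nat-+ (suc m) n = trans (nat-suc (m ℕ.+ n)) (trans (cong (1ℚ +_) (nat-+ m n))
    (trans (sym (ℚ.+-assoc 1ℚ (nat m) (nat n))) (cong (_+ nat n) (sym (nat-suc m)))))

  recip-+ : ∀ m n → (1ℚ + (nat m + nat n)) * recip (m ℕ.+ n) ≡ 1ℚ
  recip-+ m n = subst (λ z → z * recip (m ℕ.+ n) ≡ 1ℚ)
    (trans (nat-suc (m ℕ.+ n)) (cong (1ℚ +_) (nat-+ m n))) (nat*recip (m ℕ.+ n))

  -- M² - J² = (N - I)(M + I + 1), whose second factor cancels `r`, while the factor M + I = N + I +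
  -- 1 of M² - I² cancels `s`. The reciprocals and successors enter as variables with equations,
  -- which leaves pure ring identities.
  weight-shift-step : ∀ {M J} N I w v r s → M ≡ 1ℚ + N → J ≡ 1ℚ + I →
    (1ℚ + (M + I)) * r ≡ 1ℚ → (1ℚ + (N + I)) * s ≡ 1ℚ →
    (M * M - I * I) * w ≡ M * M * v →
    (M * M - J * J) * - (w * ((M - I) * r)) ≡ M * M * - (v * ((N - I) * s))
  weight-shift-step N I w v r s refl refl hr hs h = begin-equality
    ((1ℚ + N) * (1ℚ + N) - (1ℚ + I) * (1ℚ + I)) * - (w * (((1ℚ + N) - I) * r))
      ≡⟨ solve 4 (λ N I w r →
           ((con 1ℚ :+ N) :* (con 1ℚ :+ N) :- (con 1ℚ :+ I) :* (con 1ℚ :+ I)) :* :- (w :* (((con 1ℚ :+ N) :- I) :* r))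
           := :- ((N :- I) :* ((con 1ℚ :+ N) :- I) :* w :* ((con 1ℚ :+ ((con 1ℚ :+ N) :+ I)) :* r)))
           refl N I w r ⟩
    - ((N - I) * ((1ℚ + N) - I) * w * ((1ℚ + ((1ℚ + N) + I)) * r))
      ≡⟨ cong (λ z → - ((N - I) * ((1ℚ + N) - I) * w * z)) (trans hr (sym hs)) ⟩
    - ((N - I) * ((1ℚ + N) - I) * w * ((1ℚ + (N + I)) * s))
      ≡⟨ solve 4 (λ N I w s →
           :- ((N :- I) :* ((con 1ℚ :+ N) :- I) :* w :* ((con 1ℚ :+ (N :+ I)) :* s))
           := :- (((con 1ℚ :+ N) :* (con 1ℚ :+ N) :- I :* I) :* w :* ((N :- I) :* s)))
           refl N I w s ⟩
    - (((1ℚ + N) * (1ℚ + N) - I * I) * w * ((N - I) * s))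
      ≡⟨ cong (λ z → - (z * ((N - I) * s))) h ⟩
    - ((1ℚ + N) * (1ℚ + N) * v * ((N - I) * s))
      ≡⟨ solve 3 (λ m v t → :- (m :* v :* t) := m :* :- (v :* t)) refl ((1ℚ + N) * (1ℚ + N)) v ((N - I) * s) ⟩
    (1ℚ + N) * (1ℚ + N) * - (v * ((N - I) * s)) ∎

  -- With n = m + 1, the factor n² - i² = (n - i)(n + i) shortens both factorials in the denominator
  -- of the weight, and (n!)² = n² (m!)².
  weight-shift : ∀ m i →
    (nat (suc m) * nat (suc m) - nat i * nat i) * weight (suc m) i ≡ nat (suc m) * nat (suc m) * weight m i
  weight-shift m zero    = solve 1 (λ n → (n :- con 0ℚ :* con 0ℚ) :* con 1ℚ := n :* con 1ℚ) refl
    (nat (suc m) * nat (suc m))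
  weight-shift m (suc i) = weight-shift-step (nat m) (nat i) (weight (suc m) i) (weight m i)
    (recip (suc m ℕ.+ i)) (recip (m ℕ.+ i)) (nat-suc m) (nat-suc i)
    (recip-+ (suc m) i) (recip-+ m i) (weight-shift m i)

  weight-beyond : ∀ n → weight n (suc n) ≡ 0ℚ
  weight-beyond n = trans (cong (λ z → - (weight n n * (z * recip (n ℕ.+ n)))) (ℚ.+-inverseʳ (nat n)))
    (solve 2 (λ w r → :- (w :* (con 0ℚ :* r)) := con 0ℚ) refl (weight n n) (recip (n ℕ.+ n)))

  -- Each step multiplies by a factor of size |n - i| / (n + i + 1) ≤ 1, also beyond i = n.
  ∣weight∣≤1 : ∀ n i → ∣ weight n i ∣ ≤ 1ℚ
  ∣weight∣≤1 n zero    = ℚ.≤-refl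
  ∣weight∣≤1 n (suc i) = begin
    ∣ - (weight n i * step) ∣      ≡⟨ ℚ.∣-p∣≡∣p∣ (weight n i * step) ⟩
    ∣ weight n i * step ∣          ≡⟨ ℚ.∣p*q∣≡∣p∣*∣q∣ (weight n i) step ⟩
    ∣ weight n i ∣ * ∣ step ∣      ≤⟨ *-mono (ℚ.nonNegative⁻¹ 1ℚ) (ℚ.0≤∣p∣ step) (∣weight∣≤1 n i) ∣step∣≤1 ⟩
    1ℚ * 1ℚ                        ≡⟨ ℚ.*-identityˡ 1ℚ ⟩
    1ℚ                             ∎
    where
    step : ℚ
    step = (nat n - nat i) * recip (n ℕ.+ i)
    ∣step∣≤1 : ∣ step ∣ ≤ 1ℚ
    ∣step∣≤1 = begin
      ∣ step ∣                                      ≡⟨ ℚ.∣p*q∣≡∣p∣*∣q∣ (nat n - nat i) (recip (n ℕ.+ i)) ⟩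
      ∣ nat n - nat i ∣ * ∣ recip (n ℕ.+ i) ∣       ≡⟨ cong (∣ nat n - nat i ∣ *_) (recip-abs (n ℕ.+ i)) ⟩
      ∣ nat n - nat i ∣ * recip (n ℕ.+ i)           ≤⟨ ℚ.*-monoʳ-≤-nonNeg (recip (n ℕ.+ i)) {{ℚ.nonNegative (0≤recip (n ℕ.+ i))}} bound′ ⟩
      (1ℚ + (nat n + nat i)) * recip (n ℕ.+ i)      ≡⟨ recip-+ n i ⟩
      1ℚ                                            ∎
      where
      bound′ : ∣ nat n - nat i ∣ ≤ 1ℚ + (nat n + nat i)
      bound′ = begin
        ∣ nat n - nat i ∣         ≤⟨ ℚ.∣p-q∣≤∣p∣+∣q∣ (nat n) (nat i) ⟩
        ∣ nat n ∣ + ∣ nat i ∣     ≡⟨ cong₂ _+_ (ℚ.0≤p⇒∣p∣≡p (nat-≥0 n)) (ℚ.0≤p⇒∣p∣≡p (nat-≥0 i)) ⟩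
        nat n + nat i             ≤⟨ ≤-+ (nat n + nat i) (ℚ.nonNegative⁻¹ 1ℚ) ⟩
        nat n + nat i + 1ℚ        ≡⟨ ℚ.+-comm (nat n + nat i) 1ℚ ⟩
        1ℚ + (nat n + nat i)      ∎

  altSum-1-step : ∀ {J} N I S w r → J ≡ 1ℚ + I → (1ℚ + (N + I)) * r ≡ 1ℚ → S * N ≡ w * (N - I) →
    (S + (- (w * ((N - I) * r)) * 1ℚ + - (w * ((N - I) * r)) * 1ℚ)) * N ≡ - (w * ((N - I) * r)) * (N - J)
  altSum-1-step N I S w r refl hr h = begin-equality
    (S + (- (w * ((N - I) * r)) * 1ℚ + - (w * ((N - I) * r)) * 1ℚ)) * N
      ≡⟨ solve 5 (λ N S I w r → (S :+ (:- (w :* ((N :- I) :* r)) :* con 1ℚ :+ :- (w :* ((N :- I) :* r)) :* con 1ℚ)) :* N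
           := S :* N :+ :- (w :* (N :- I) :* r :* (N :+ N))) refl N S I w r ⟩
    S * N + - (w * (N - I) * r * (N + N))
      ≡⟨ cong (_+ - (w * (N - I) * r * (N + N))) (trans h (trans (sym (ℚ.*-identityʳ (w * (N - I)))) (cong (w * (N - I) *_) (sym hr)))) ⟩
    w * (N - I) * ((1ℚ + (N + I)) * r) + - (w * (N - I) * r * (N + N))
      ≡⟨ solve 4 (λ N I w r → w :* (N :- I) :* ((con 1ℚ :+ (N :+ I)) :* r) :+ :- (w :* (N :- I) :* r :* (N :+ N))
           := :- (w :* ((N :- I) :* r)) :* (N :- (con 1ℚ :+ I))) refl N I w r ⟩
    - (w * ((N - I) * r)) * (N - (1ℚ + I)) ∎

  -- The closed form of the partial sums. By the recurrence, wₖ (n - k) = -wₖ₊₁ (n + k + 1), and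
  -- adding the new term 2n wₖ₊₁ leaves wₖ₊₁ (n - k - 1).
  altSum-1 : ∀ n k → altSum n k (λ _ → 1ℚ) * nat n ≡ weight n k * (nat n - nat k)
  altSum-1 n zero    = solve 1 (λ n → con 1ℚ :* n := con 1ℚ :* (n :- con 0ℚ)) refl (nat n)
  altSum-1 n (suc k) = altSum-1-step (nat n) (nat k) (altSum n k (λ _ → 1ℚ)) (weight n k)
    (recip (n ℕ.+ k)) (nat-suc k) (recip-+ n k) (altSum-1 n k)

  -- The closed form vanishes at k = n; cancelling the factor n requires n ≥ 1.
  altSum-1≡0 : ∀ m → altSum (suc m) (suc m) (λ _ → 1ℚ) ≡ 0ℚ
  altSum-1≡0 m = begin-equality
    S                                  ≡⟨ sym (ℚ.*-identityʳ S) ⟩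
    S * 1ℚ                             ≡⟨ cong (S *_) (sym (nat*recip m)) ⟩
    S * (nat (suc m) * recip m)        ≡⟨ sym (ℚ.*-assoc S (nat (suc m)) (recip m)) ⟩
    S * nat (suc m) * recip m          ≡⟨ cong (_* recip m) (altSum-1 (suc m) (suc m)) ⟩
    w * (nat (suc m) - nat (suc m)) * recip m
                                       ≡⟨ solve 3 (λ w n r → w :* (n :- n) :* r := con 0ℚ) refl w (nat (suc m)) (recip m) ⟩
    0ℚ                                 ∎
    where
    S w : ℚ
    S = altSum (suc m) (suc m) (λ _ → 1ℚ)
    w = weight (suc m) (suc m)

  altSum-shift : ∀ m k f → altSum (suc m) k (λ i → (nat (suc m) * nat (suc m) - nat i * nat i) * f i)
                         ≡ nat (suc m) * nat (suc m) * altSum m k f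
  altSum-shift m zero    f = solve 2 (λ n a → (n :- con 0ℚ :* con 0ℚ) :* a := n :* a) refl
    (nat (suc m) * nat (suc m)) (f 0)
  altSum-shift m (suc k) f = combine (altSum m k f) (nat (suc m) * nat (suc m)) (nat (suc k) * nat (suc k))
    (f (suc k)) (weight (suc m) (suc k)) (weight m (suc k)) (altSum-shift m k f) (weight-shift m (suc k))
    where
    combine : ∀ {S′} S n j a w v → S′ ≡ n * S → (n - j) * w ≡ n * v →
      S′ + (w * ((n - j) * a) + w * ((n - j) * a)) ≡ n * (S + (v * a + v * a))
    combine S n j a w v refl h = begin-equality
      n * S + (w * ((n - j) * a) + w * ((n - j) * a))
        ≡⟨ solve 5 (λ S n j a w → n :* S :+ (w :* ((n :- j) :* a) :+ w :* ((n :- j) :* a))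
                               := n :* S :+ ((n :- j) :* w) :* (a :+ a)) refl S n j a w ⟩
      n * S + ((n - j) * w) * (a + a)
        ≡⟨ cong (λ z → n * S + z * (a + a)) h ⟩
      n * S + (n * v) * (a + a)
        ≡⟨ solve 4 (λ S n a v → n :* S :+ (n :* v) :* (a :+ a) := n :* (S :+ (v :* a :+ v :* a))) refl S n a v ⟩
      n * (S + (v * a + v * a)) ∎

  -- `altSum-shift` lowers the weights to those of m but keeps m + 1 as the last index; the extra
  -- term has weight 0.
  altSum-beyond : ∀ n f → altSum n (suc n) f ≡ altSum n n f
  altSum-beyond n f = trans
    (cong (λ w → altSum n n f + (w * f (suc n) + w * f (suc n))) (weight-beyond n))
    (solve 2 (λ S a → S :+ (con 0ℚ :* a :+ con 0ℚ :* a) := S) refl (altSum n n f) (f (suc n)))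

  -- Multiplication by i² is expressed through multiplication by N − i².
  altSum-horner : ∀ n k N a c f →
    altSum n k (λ i → a + c * (nat i * nat i) * f i)
    ≡ a * altSum n k (λ _ → 1ℚ) + c * (N * altSum n k f - altSum n k (λ i → (N - nat i * nat i) * f i))
  altSum-horner n zero    N a c f = solve 4 (λ N a c b →
    a :+ c :* (con 0ℚ :* con 0ℚ) :* b
    := a :* con 1ℚ :+ c :* (N :* b :- (N :- con 0ℚ :* con 0ℚ) :* b)) refl N a c (f 0)
  altSum-horner n (suc k) N a c f = combine (altSum n k (λ _ → 1ℚ)) (altSum n k f)
    (altSum n k (λ i → (N - nat i * nat i) * f i)) (nat (suc k) * nat (suc k)) (f (suc k))
    (weight n (suc k)) (altSum-horner n k N a c f)
    where
    combine : ∀ {S} S₁ S₂ S₃ j b w → S ≡ a * S₁ + c * (N * S₂ - S₃) →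
      S + (w * (a + c * j * b) + w * (a + c * j * b))
      ≡ a * (S₁ + (w * 1ℚ + w * 1ℚ)) + c * (N * (S₂ + (w * b + w * b))
          - (S₃ + (w * ((N - j) * b) + w * ((N - j) * b))))
    combine S₁ S₂ S₃ j b w refl = solve 9 (λ N a c S₁ S₂ S₃ j b w →
      (a :* S₁ :+ c :* (N :* S₂ :- S₃)) :+ (w :* (a :+ c :* j :* b) :+ w :* (a :+ c :* j :* b))
      := a :* (S₁ :+ (w :* con 1ℚ :+ w :* con 1ℚ)) :+ c :* (N :* (S₂ :+ (w :* b :+ w :* b))
          :- (S₃ :+ (w :* ((N :- j) :* b) :+ w :* ((N :- j) :* b))))) refl N a c S₁ S₂ S₃ j b w

  altSum-0 : ∀ n k → altSum n k (λ _ → 0ℚ) ≡ 0ℚ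
  altSum-0 n zero    = refl
  altSum-0 n (suc k) = trans (cong (_+ (weight n (suc k) * 0ℚ + weight n (suc k) * 0ℚ)) (altSum-0 n k))
    (solve 1 (λ w → con 0ℚ :+ (w :* con 0ℚ :+ w :* con 0ℚ) := con 0ℚ) refl (weight n (suc k)))

  -- Induction on the coefficients. The tail is needed with the weights of m + 1 and, after the
  -- shift, with those of m, hence the claim for every n from the length upwards.
  altSum-poly : ∀ c p n → length p ℕ.≤ n → altSum n n (λ i → evalℚ p (c * (nat i * nat i))) ≡ 0ℚ
  altSum-poly c []      n       _         = altSum-0 n n
  altSum-poly c (a ∷ p) (suc m) (ℕ.s≤s h) = begin-equality
    altSum (suc m) (suc m) (λ i → a + c * (nat i * nat i) * f i)
      ≡⟨ altSum-horner (suc m) (suc m) N a c f ⟩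
    a * altSum (suc m) (suc m) (λ _ → 1ℚ)
      + c * (N * altSum (suc m) (suc m) f - altSum (suc m) (suc m) (λ i → (N - nat i * nat i) * f i))
      ≡⟨ cong₂ (λ x y → a * x + c * y) (altSum-1≡0 m)
           (cong₂ (λ x y → N * x - y) (altSum-poly c p (suc m) (ℕ.m≤n⇒m≤1+n h))
             (trans (altSum-shift m (suc m) f)
               (cong (N *_) (trans (altSum-beyond m f) (altSum-poly c p m h))))) ⟩
    a * 0ℚ + c * (N * 0ℚ - N * 0ℚ)
      ≡⟨ solve 3 (λ a c N → a :* con 0ℚ :+ c :* (N :* con 0ℚ :- N :* con 0ℚ) := con 0ℚ) refl a c N ⟩
    0ℚ ∎
    where
    N : ℚ
    N = nat (suc m) * nat (suc m)
    f : ℕ → ℚ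
    f i = evalℚ p (c * (nat i * nat i))

  -- The majorant is given as differences of `u`, so that its sum telescopes; the doubling is the
  -- factor 2 in `altSum`.
  altSum-bound : ∀ n k f (u : ℕ → ℚ) → (∀ i → i ℕ.< k → ∣ f (suc i) ∣ ≤ u i - u (suc i)) →
    ∣ altSum n k f - f 0 ∣ ≤ (u 0 - u k) + (u 0 - u k)
  altSum-bound n zero    f u h = ℚ.≤-reflexive (trans (cong ∣_∣ (ℚ.+-inverseʳ (f 0)))
    (solve 1 (λ u → con 0ℚ := (u :- u) :+ (u :- u)) refl (u 0)))
  altSum-bound n (suc k) f u h = begin
    ∣ S + (w * a + w * a) - f 0 ∣
      ≡⟨ cong ∣_∣ (solve 3 (λ S t z → S :+ (t :+ t) :- z := (S :- z) :+ (t :+ t)) refl S (w * a) (f 0)) ⟩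
    ∣ (S - f 0) + (w * a + w * a) ∣
      ≤⟨ ℚ.≤-trans (ℚ.∣p+q∣≤∣p∣+∣q∣ (S - f 0) (w * a + w * a))
           (ℚ.+-monoʳ-≤ ∣ S - f 0 ∣ (ℚ.∣p+q∣≤∣p∣+∣q∣ (w * a) (w * a))) ⟩
    ∣ S - f 0 ∣ + (∣ w * a ∣ + ∣ w * a ∣)
      ≤⟨ ℚ.+-mono-≤ (altSum-bound n k f u (λ i i<k → h i (ℕ.m≤n⇒m≤1+n i<k))) (ℚ.+-mono-≤ small small) ⟩
    (u 0 - u k) + (u 0 - u k) + ((u k - u (suc k)) + (u k - u (suc k)))
      ≡⟨ solve 3 (λ x y z → (x :- y) :+ (x :- y) :+ ((y :- z) :+ (y :- z)) := (x :- z) :+ (x :- z))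
           refl (u 0) (u k) (u (suc k)) ⟩
    (u 0 - u (suc k)) + (u 0 - u (suc k)) ∎
    where
    S w a : ℚ
    S = altSum n k f
    w = weight n (suc k)
    a = f (suc k)
    small : ∣ w * a ∣ ≤ u k - u (suc k)
    small = begin
      ∣ w * a ∣           ≡⟨ ℚ.∣p*q∣≡∣p∣*∣q∣ w a ⟩
      ∣ w ∣ * ∣ a ∣       ≤⟨ ℚ.*-monoʳ-≤-nonNeg ∣ a ∣ {{ℚ.nonNegative (ℚ.0≤∣p∣ a)}} (∣weight∣≤1 n (suc k)) ⟩
      1ℚ * ∣ a ∣          ≡⟨ ℚ.*-identityˡ ∣ a ∣ ⟩
      ∣ a ∣               ≤⟨ h k ℕ.≤-refl ⟩
      u k - u (suc k)     ∎

  -- Division by x - c and the bound on p(0) - p(1).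

  evalℚ-quotient : ∀ c p x → evalℚ p x - evalℚ p c ≡ (x - c) * evalℚ (quotient c p) x
  evalℚ-quotient c []          x = solve 2 (λ x c → con 0ℚ :- con 0ℚ := (x :- c) :* con 0ℚ) refl x c
  evalℚ-quotient c (a ∷ [])    x = solve 3 (λ a x c →
    (a :+ x :* con 0ℚ) :- (a :+ c :* con 0ℚ) := (x :- c) :* con 0ℚ) refl a x c
  evalℚ-quotient c (a ∷ p@(_ ∷ _)) x = combine (evalℚ p x) (evalℚ p c) (evalℚ (quotient c p) x)
    (evalℚ-quotient c p x)
    where
    combine : ∀ y z q → y - z ≡ (x - c) * q → (a + x * y) - (a + c * z) ≡ (x - c) * (z + x * q)
    combine y z q h = begin-equality
      (a + x * y) - (a + c * z)        ≡⟨ solve 5 (λ a x c y z → (a :+ x :* y) :- (a :+ c :* z)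
                                             := x :* (y :- z) :+ (x :- c) :* z) refl a x c y z ⟩
      x * (y - z) + (x - c) * z        ≡⟨ cong (λ t → x * t + (x - c) * z) h ⟩
      x * ((x - c) * q) + (x - c) * z  ≡⟨ solve 4 (λ x c z q → x :* ((x :- c) :* q) :+ (x :- c) :* z
                                             := (x :- c) :* (z :+ x :* q)) refl x c z q ⟩
      (x - c) * (z + x * q)            ∎

  length-quotient : ∀ c p {d} → length p ℕ.≤ suc d → length (quotient c p) ℕ.≤ d
  length-quotient c []          h = ℕ.z≤n
  length-quotient c (a ∷ [])    h = ℕ.z≤n
  length-quotient c (a ∷ p@(_ ∷ _)) {suc d} (ℕ.s≤s h) = ℕ.s≤s (length-quotient c p h)

  -- 1/(9s² − 1) ≤ (2/9) (1/(2s − 1) − 1/(2s + 1))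
  telescope : ∀ i → 1ℚ ≤ (node (suc i) - 1ℚ) * (ℤ.+ 2 / 9 * (recip (i ℕ.+ i) - recip (suc i ℕ.+ suc i)))
  telescope i = algebra (nat i) (recip (i ℕ.+ i)) (recip (suc i ℕ.+ suc i)) (nat-suc i)
    (recip-+ i i) (recip-+ (suc i) (suc i)) (0≤recip (i ℕ.+ i)) (0≤recip (suc i ℕ.+ suc i))
    where
    algebra : ∀ {J} I r s → J ≡ 1ℚ + I → (1ℚ + (I + I)) * r ≡ 1ℚ → (1ℚ + (J + J)) * s ≡ 1ℚ →
      0ℚ ≤ r → 0ℚ ≤ s → 1ℚ ≤ (nat 9 * (J * J) - 1ℚ) * (ℤ.+ 2 / 9 * (r - s))
    -- Here r = 1/A and s = 1/B with B = A + 2 and 4J² = AB + 1, so r - s = 2rs and 9J² - 1 = (9AB +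
    -- 5)/4: the excess over 1 is 5/9 · rs.
    algebra I r s refl hr hs 0≤r 0≤s = ≤-diff {r = ℤ.+ 5 / 9 * (r * s)} (0≤* (ℚ.nonNegative⁻¹ (ℤ.+ 5 / 9)) (0≤* 0≤r 0≤s)) (begin-equality
      (nat 9 * (J * J) - 1ℚ) * (ℤ.+ 2 / 9 * (r - s)) - 1ℚ
        -- Inserting Bs = 1 and Ar = 1 makes both reciprocals multiples of rs, after which no
        -- division is left.
        ≡⟨ cong₂ (λ x y → (nat 9 * (J * J) - 1ℚ) * (ℤ.+ 2 / 9 * (x - y)) - 1ℚ)
             (trans (sym (ℚ.*-identityʳ r)) (cong (r *_) (sym hs)))
             (trans (sym (ℚ.*-identityʳ s)) (cong (s *_) (sym hr))) ⟩
      (nat 9 * (J * J) - 1ℚ) * (ℤ.+ 2 / 9 * (r * (B * s) - s * (A * r))) - 1ℚ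
        ≡⟨ solve 3 (λ I r s → let J = con 1ℚ :+ I ; A = con 1ℚ :+ (I :+ I) ; B = con 1ℚ :+ (J :+ J) in
             (con (nat 9) :* (J :* J) :- con 1ℚ) :* (con (ℤ.+ 2 / 9) :* (r :* (B :* s) :- s :* (A :* r))) :- con 1ℚ
             := ((A :* r) :* (B :* s) :- con 1ℚ) :+ con (ℤ.+ 5 / 9) :* (r :* s)) refl I r s ⟩
      ((A * r) * (B * s) - 1ℚ) + ℤ.+ 5 / 9 * (r * s)
        ≡⟨ cong₂ (λ x y → (x * y - 1ℚ) + ℤ.+ 5 / 9 * (r * s)) hr hs ⟩
      (1ℚ * 1ℚ - 1ℚ) + ℤ.+ 5 / 9 * (r * s)
        ≡⟨ solve 1 (λ t → (con 1ℚ :* con 1ℚ :- con 1ℚ) :+ t := t) refl (ℤ.+ 5 / 9 * (r * s)) ⟩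
      ℤ.+ 5 / 9 * (r * s) ∎)
      where
      J A B : ℚ
      J = 1ℚ + I
      A = 1ℚ + (I + I)
      B = 1ℚ + (J + J)

  -- Replaces division by m by multiplication with an upper bound t for 1/m.
  ≤-of-scaled : ∀ {m a C t} → 0ℚ ≤ a → 0ℚ ≤ m → 0ℚ ≤ t → 1ℚ ≤ m * t → m * a ≤ C → a ≤ C * t
  ≤-of-scaled {m} {a} {C} {t} 0≤a 0≤m 0≤t h₁ h₂ = begin
    a             ≡⟨ sym (ℚ.*-identityʳ a) ⟩
    a * 1ℚ        ≤⟨ ℚ.*-monoˡ-≤-nonNeg a {{ℚ.nonNegative 0≤a}} h₁ ⟩
    a * (m * t)   ≡⟨ solve 3 (λ a m t → a :* (m :* t) := m :* a :* t) refl a m t ⟩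
    m * a * t     ≤⟨ ℚ.*-monoʳ-≤-nonNeg t {{ℚ.nonNegative 0≤t}} h₂ ⟩
    C * t         ∎

  1≤node : ∀ i → 1ℚ ≤ node (suc i)
  1≤node i = begin
    1ℚ * (1ℚ * 1ℚ)   ≤⟨ *-mono (nat-≥0 9) (ℚ.nonNegative⁻¹ (1ℚ * 1ℚ)) (nat-mono {1} {9} (ℕ.s≤s ℕ.z≤n))
                     (*-mono (nat-≥0 (suc i)) (ℚ.nonNegative⁻¹ 1ℚ) 1≤ 1≤) ⟩
    node (suc i)     ∎
    where
    1≤ : 1ℚ ≤ nat (suc i)
    1≤ = nat-mono {1} {suc i} (ℕ.s≤s ℕ.z≤n)

  -- The quotient q by x - 1 has at most d coefficients, so the functional annihilates it. Its term
  -- at node 0 is q(0) = p(1) - p(0), which the terms at the other nodes must therefore balance.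
  drop-bound : ∀ p d C → length p ℕ.≤ suc d → 0ℚ ≤ C →
    (∀ i → i ℕ.< d → ∣ evalℚ p (node (suc i)) - evalℚ p 1ℚ ∣ ≤ C) →
    evalℚ p 0ℚ - evalℚ p 1ℚ ≤ ℤ.+ 4 / 9 * C
  drop-bound p d C len 0≤C h = begin
    evalℚ p 0ℚ - evalℚ p 1ℚ
      ≡⟨ evalℚ-quotient 1ℚ p 0ℚ ⟩
    (0ℚ - 1ℚ) * f 0
      ≡⟨ solve 1 (λ a → (con 0ℚ :- con 1ℚ) :* a := con 0ℚ :- a) refl (f 0) ⟩
    0ℚ - f 0
      ≡⟨ cong (_- f 0) (sym (altSum-poly (nat 9) q d (length-quotient 1ℚ p len))) ⟩
    altSum d d f - f 0
      ≤⟨ ≤∣∣ (altSum d d f - f 0) ⟩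
    ∣ altSum d d f - f 0 ∣
      ≤⟨ altSum-bound d d f u small ⟩
    (u 0 - u d) + (u 0 - u d)
      -- `u 0` is 2/9 · C because `recip 0` is 1.
      ≤⟨ ≤-diff {r = u d + u d} (ℚ.+-mono-≤ (0≤u d) (0≤u d))
           (solve 2 (λ c y → con (ℤ.+ 4 / 9) :* c :- ((c :* (con (ℤ.+ 2 / 9) :* con 1ℚ) :- y) :+ (c :* (con (ℤ.+ 2 / 9) :* con 1ℚ) :- y)) := y :+ y) refl C (u d)) ⟩
    ℤ.+ 4 / 9 * C ∎
    where
    q : List ℚ
    q = quotient 1ℚ p
    f u : ℕ → ℚ
    f i = evalℚ q (node i)
    -- This is (2/9) C / (2i + 1); by `telescope` its consecutive differences dominate C / (9(i +
    -- 1)² - 1).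
    u i = C * (ℤ.+ 2 / 9 * recip (i ℕ.+ i))
    0≤u : ∀ i → 0ℚ ≤ u i
    0≤u i = 0≤* 0≤C (0≤* (ℚ.nonNegative⁻¹ (ℤ.+ 2 / 9)) (0≤recip (i ℕ.+ i)))
    small : ∀ i → i ℕ.< d → ∣ f (suc i) ∣ ≤ u i - u (suc i)
    small i i<d = subst (∣ f (suc i) ∣ ≤_)
      (solve 4 (λ c k r s → c :* (k :* (r :- s)) := c :* (k :* r) :- c :* (k :* s)) refl
        C (ℤ.+ 2 / 9) (recip (i ℕ.+ i)) (recip (suc i ℕ.+ suc i)))
      (≤-of-scaled {node (suc i) - 1ℚ} (ℚ.0≤∣p∣ (f (suc i))) 0≤m
        (0≤* (ℚ.nonNegative⁻¹ (ℤ.+ 2 / 9)) (0≤- (recip-anti (ℕ.+-mono-≤ (ℕ.n≤1+n i) (ℕ.n≤1+n i)))))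
        (telescope i)
        (subst (_≤ C) (trans (cong ∣_∣ (evalℚ-quotient 1ℚ p (node (suc i))))
            (trans (ℚ.∣p*q∣≡∣p∣*∣q∣ (node (suc i) - 1ℚ) (f (suc i)))
              (cong (_* ∣ f (suc i) ∣) (ℚ.0≤p⇒∣p∣≡p 0≤m))))
          (h i i<d)))
      where
      0≤m : 0ℚ ≤ node (suc i) - 1ℚ
      0≤m = 0≤- (1≤node i)

 -- Slack absorbing the errors of working with approximations of the reals.
 η : ℚ
 η = ℤ.+ 1 / 64

 -- Cauchy products of exponential series.

 partialSum : (ℕ → ℚ) → ℕ → ℚ
 partialSum f zero    = f 0
 partialSum f (suc n) = partialSum f n + f (suc n)

 -- Shifting `f` instead of indexing `g` by n - i avoids truncated subtraction.
 cauchyProduct : (ℕ → ℚ) → (ℕ → ℚ) → ℕ → ℚ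
 cauchyProduct f g zero    = f 0 * g 0
 cauchyProduct f g (suc n) = f 0 * g (suc n) + cauchyProduct (f ∘ suc) g n

 -- The formal derivative of the power series with coefficients `f`.
 derivative : (ℕ → ℚ) → ℕ → ℚ
 derivative f k = nat (suc k) * f (suc k)

 -- The sum of f(i) g(j) over the triangle i + j ≤ n.
 triangleSum : (ℕ → ℚ) → (ℕ → ℚ) → ℕ → ℚ
 triangleSum f g = partialSum (cauchyProduct f g)

 abstract

  cauchyProduct-cong-+ˡ : ∀ {f f₁ f₂} g → (∀ k → f k ≡ f₁ k + f₂ k) →
    ∀ n → cauchyProduct f g n ≡ cauchyProduct f₁ g n + cauchyProduct f₂ g n
  cauchyProduct-cong-+ˡ {f₁ = f₁} {f₂} g h zero = trans (cong (_* g 0) (h 0)) (ℚ.*-distribʳ-+ (g 0) (f₁ 0) (f₂ 0))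
  cauchyProduct-cong-+ˡ {f₁ = f₁} {f₂} g h (suc n) = trans
    (cong₂ (λ x y → x * g (suc n) + y) (h 0) (cauchyProduct-cong-+ˡ g (h ∘ suc) n))
    (solve 5 (λ a b c x y → (a :+ b) :* c :+ (x :+ y) := (a :* c :+ x) :+ (b :* c :+ y)) refl
      (f₁ 0) (f₂ 0) (g (suc n)) (cauchyProduct (f₁ ∘ suc) g n) (cauchyProduct (f₂ ∘ suc) g n))

  cauchyProduct-scaleˡ : ∀ {f f₁} a g → (∀ k → f k ≡ a * f₁ k) →
    ∀ n → cauchyProduct f g n ≡ a * cauchyProduct f₁ g n
  cauchyProduct-scaleˡ {f₁ = f₁} a g h zero = trans (cong (_* g 0) (h 0)) (ℚ.*-assoc a (f₁ 0) (g 0))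
  cauchyProduct-scaleˡ {f₁ = f₁} a g h (suc n) = trans
    (cong₂ (λ x y → x * g (suc n) + y) (h 0) (cauchyProduct-scaleˡ a g (h ∘ suc) n))
    (solve 4 (λ a b c x → a :* b :* c :+ a :* x := a :* (b :* c :+ x)) refl
      a (f₁ 0) (g (suc n)) (cauchyProduct (f₁ ∘ suc) g n))

  cauchyProduct-scaleʳ : ∀ {g g₁} a f → (∀ k → g k ≡ a * g₁ k) →
    ∀ n → cauchyProduct f g n ≡ a * cauchyProduct f g₁ n
  cauchyProduct-scaleʳ {g₁ = g₁} a f h zero = trans (cong (f 0 *_) (h 0))
    (solve 3 (λ a b c → b :* (a :* c) := a :* (b :* c)) refl a (f 0) (g₁ 0))
  cauchyProduct-scaleʳ {g₁ = g₁} a f h (suc n) = trans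
    (cong₂ (λ x y → f 0 * x + y) (h (suc n)) (cauchyProduct-scaleʳ a (f ∘ suc) h n))
    (solve 4 (λ a b c x → b :* (a :* c) :+ a :* x := a :* (b :* c :+ x)) refl
      a (f 0) (g₁ (suc n)) (cauchyProduct (f ∘ suc) g₁ n))

  leibniz : ∀ f g n → nat (suc n) * cauchyProduct f g (suc n)
                    ≡ cauchyProduct (derivative f) g n + cauchyProduct f (derivative g) n
  leibniz f g zero = solve 4 (λ a b c d →
    con 1ℚ :* (a :* d :+ b :* c) := con 1ℚ :* b :* c :+ a :* (con 1ℚ :* d)) refl (f 0) (f 1) (g 0) (g 1)
  leibniz f g (suc n) = algebra (nat (suc n)) (f 0) (f 1) (g (suc n)) (g (suc (suc n)))
    (cauchyProduct (f ∘ suc ∘ suc) g n) (cauchyProduct (derivative (f ∘ suc)) g n)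
    (cauchyProduct (f ∘ suc) (derivative g) n)
    (nat-suc (suc n)) (leibniz (f ∘ suc) g n)
    -- Shift and derivative do not commute: (k + 2) f(k + 2) is the derivative of the shifted
    -- sequence at k plus f(k + 2).
    (cauchyProduct-cong-+ˡ g (λ k → trans (cong (_* f (suc (suc k))) (nat-suc (suc k)))
      (solve 2 (λ n a → (con 1ℚ :+ n) :* a := n :* a :+ a) refl (nat (suc k)) (f (suc (suc k))))) n)
    where
    algebra : ∀ {N₂ y} N₁ a b c d x y₁ z → N₂ ≡ 1ℚ + N₁ → N₁ * (b * c + x) ≡ y₁ + z → y ≡ y₁ + x →
      N₂ * (a * d + (b * c + x)) ≡ (1ℚ * b) * c + y + (a * (N₂ * d) + z)
    algebra N₁ a b c d x y₁ z refl h refl = begin-equality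
      (1ℚ + N₁) * (a * d + (b * c + x))
        ≡⟨ solve 6 (λ N₁ a b c d x → (con 1ℚ :+ N₁) :* (a :* d :+ (b :* c :+ x))
             := a :* ((con 1ℚ :+ N₁) :* d) :+ (b :* c :+ x) :+ N₁ :* (b :* c :+ x)) refl N₁ a b c d x ⟩
      a * ((1ℚ + N₁) * d) + (b * c + x) + N₁ * (b * c + x)
        ≡⟨ cong (λ t → a * ((1ℚ + N₁) * d) + (b * c + x) + t) h ⟩
      a * ((1ℚ + N₁) * d) + (b * c + x) + (y₁ + z)
        ≡⟨ solve 6 (λ t b c x y z → t :+ (b :* c :+ x) :+ (y :+ z)
             := con 1ℚ :* b :* c :+ (y :+ x) :+ (t :+ z)) refl (a * ((1ℚ + N₁) * d)) b c x y₁ z ⟩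
      (1ℚ * b) * c + (y₁ + x) + (a * ((1ℚ + N₁) * d) + z) ∎

  derivative-expTerm : ∀ q k → derivative (expTerm q) k ≡ q * expTerm q k
  derivative-expTerm q k = trans
    (solve 4 (λ n t q r → n :* (t :* (q :* r)) := q :* t :* (n :* r)) refl (nat (suc k)) (expTerm q k) q (recip k))
    (trans (cong (q * expTerm q k *_) (nat*recip k)) (ℚ.*-identityʳ (q * expTerm q k)))

  -- The binomial theorem without binomial coefficients: by the product rule the Cauchy product
  -- satisfies (n + 1) cₙ₊₁ = (a + b) cₙ, the recurrence of `expTerm (a + b)`.
  expTerm-+ : ∀ a b n → cauchyProduct (expTerm a) (expTerm b) n ≡ expTerm (a + b) n
  expTerm-+ a b zero    = refl
  expTerm-+ a b (suc n) = begin-equality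
    c (suc n)                               ≡⟨ sym (*-recip-cancel n (c (suc n))) ⟩
    nat (suc n) * (c (suc n) * recip n)     ≡⟨ sym (ℚ.*-assoc (nat (suc n)) (c (suc n)) (recip n)) ⟩
    nat (suc n) * c (suc n) * recip n       ≡⟨ cong (_* recip n) (leibniz (expTerm a) (expTerm b) n) ⟩
    (cauchyProduct (derivative (expTerm a)) (expTerm b) n
      + cauchyProduct (expTerm a) (derivative (expTerm b)) n) * recip n
      ≡⟨ cong₂ (λ x y → (x + y) * recip n)
           (cauchyProduct-scaleˡ a (expTerm b) (derivative-expTerm a) n)
           (cauchyProduct-scaleʳ b (expTerm a) (derivative-expTerm b) n) ⟩
    (a * c n + b * c n) * recip n           ≡⟨ cong (λ x → (a * x + b * x) * recip n) (expTerm-+ a b n) ⟩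
    (a * t + b * t) * recip n               ≡⟨ solve 4 (λ a b t r → (a :* t :+ b :* t) :* r := t :* ((a :+ b) :* r))
                                                 refl a b t (recip n) ⟩
    t * ((a + b) * recip n)                 ∎
    where
    c : ℕ → ℚ
    c = cauchyProduct (expTerm a) (expTerm b)
    t : ℚ
    t = expTerm (a + b) n

  expSum≡partialSum : ∀ q n → expSum q n ≡ partialSum (expTerm q) n
  expSum≡partialSum q zero    = refl
  expSum≡partialSum q (suc n) = cong (_+ expTerm q (suc n)) (expSum≡partialSum q n)

  partialSum-cong : ∀ {f g} → (∀ k → f k ≡ g k) → ∀ n → partialSum f n ≡ partialSum g n
  partialSum-cong h zero    = h 0
  partialSum-cong h (suc n) = cong₂ _+_ (partialSum-cong h n) (h (suc n))

  partialSum-mono : ∀ {f g} → (∀ k → f k ≤ g k) → ∀ n → partialSum f n ≤ partialSum g n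
  partialSum-mono h zero    = h 0
  partialSum-mono h (suc n) = ℚ.+-mono-≤ (partialSum-mono h n) (h (suc n))

  partialSum-head : ∀ f n → partialSum f (suc n) ≡ f 0 + partialSum (f ∘ suc) n
  partialSum-head f zero    = refl
  partialSum-head f (suc n) = trans (cong (_+ f (suc (suc n))) (partialSum-head f n))
    (ℚ.+-assoc (f 0) (partialSum (f ∘ suc) n) (f (suc (suc n))))

  partialSum-≥0 : ∀ {f} → (∀ k → 0ℚ ≤ f k) → ∀ n → 0ℚ ≤ partialSum f n
  partialSum-≥0 h zero    = h 0
  partialSum-≥0 h (suc n) = ℚ.+-mono-≤ (partialSum-≥0 h n) (h (suc n))

  partialSum-∣∣ : ∀ {f F} → (∀ k → ∣ f k ∣ ≤ F k) → ∀ {m n} → m ℕ.≤′ n →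
    ∣ partialSum f n - partialSum f m ∣ ≤ partialSum F n - partialSum F m
  partialSum-∣∣ {f} {F} h {m} (ℕ.≤′-reflexive refl) = ℚ.≤-reflexive
    (trans (cong ∣_∣ (ℚ.+-inverseʳ (partialSum f m))) (sym (ℚ.+-inverseʳ (partialSum F m))))
  partialSum-∣∣ {f} {F} h {m} {suc n} (ℕ.≤′-step m≤n) = begin
    ∣ partialSum f n + f (suc n) - partialSum f m ∣
      ≡⟨ cong ∣_∣ (swap (partialSum f n) (f (suc n)) (partialSum f m)) ⟩
    ∣ (partialSum f n - partialSum f m) + f (suc n) ∣
      ≤⟨ ℚ.∣p+q∣≤∣p∣+∣q∣ (partialSum f n - partialSum f m) (f (suc n)) ⟩
    ∣ partialSum f n - partialSum f m ∣ + ∣ f (suc n) ∣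
      ≤⟨ ℚ.+-mono-≤ (partialSum-∣∣ h m≤n) (h (suc n)) ⟩
    (partialSum F n - partialSum F m) + F (suc n)
      ≡⟨ sym (swap (partialSum F n) (F (suc n)) (partialSum F m)) ⟩
    partialSum F n + F (suc n) - partialSum F m ∎
    where
    swap : ∀ a b c → a + b - c ≡ (a - c) + b
    swap = solve 3 (λ a b c → a :+ b :- c := (a :- c) :+ b) refl

  partialSum-grows : ∀ {f} → (∀ k → 0ℚ ≤ f k) → ∀ m n → partialSum f n ≤ partialSum f (m ℕ.+ n)
  partialSum-grows h zero    n = ℚ.≤-refl
  partialSum-grows {f} h (suc m) n = ℚ.≤-trans (partialSum-grows h m n)
    (≤-+ (partialSum f (m ℕ.+ n)) (h (suc (m ℕ.+ n))))

  -- Splits the triangle into its column i = 0 and the smaller triangle of the shifted `f`.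
  triangleSum-head : ∀ f g n →
    triangleSum f g (suc n) ≡ f 0 * partialSum g (suc n) + triangleSum (f ∘ suc) g n
  triangleSum-head f g zero    = solve 4 (λ a b c d →
    a :* b :+ (a :* c :+ d) := a :* (b :+ c) :+ d) refl (f 0) (g 0) (g 1) (f 1 * g 0)
  triangleSum-head f g (suc n) = trans
    (cong (_+ (f 0 * g (suc (suc n)) + cauchyProduct (f ∘ suc) g (suc n))) (triangleSum-head f g n))
    (solve 5 (λ a s b t c → (a :* s :+ t) :+ (a :* b :+ c) := a :* (s :+ b) :+ (t :+ c)) refl
      (f 0) (partialSum g (suc n)) (g (suc (suc n))) (triangleSum (f ∘ suc) g n)
      (cauchyProduct (f ∘ suc) g (suc n)))

  rectangle-head : ∀ f g n N →
    partialSum f (suc n) * partialSum g N - triangleSum f g (suc n)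
    ≡ f 0 * (partialSum g N - partialSum g (suc n))
      + (partialSum (f ∘ suc) n * partialSum g N - triangleSum (f ∘ suc) g n)
  rectangle-head f g n N = trans
    (cong₂ (λ x y → x * partialSum g N - y) (partialSum-head f n) (triangleSum-head f g n))
    (solve 5 (λ a s S r t → (a :+ s) :* S :- (a :* r :+ t) := a :* (S :- r) :+ (s :* S :- t)) refl
      (f 0) (partialSum (f ∘ suc) n) (partialSum g N) (partialSum g (suc n)) (triangleSum (f ∘ suc) g n))

  ∣*∣-mono : ∀ a b {A B} → ∣ a ∣ ≤ A → ∣ b ∣ ≤ B → ∣ a * b ∣ ≤ A * B
  ∣*∣-mono a b {A} {B} ha hb = subst (_≤ A * B) (sym (ℚ.∣p*q∣≡∣p∣*∣q∣ a b))
    (*-mono (ℚ.≤-trans (ℚ.0≤∣p∣ a) ha) (ℚ.0≤∣p∣ b) ha hb)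

  -- Rectangle minus triangle is the sum over i ≤ n, j ≤ N with i + j > n, and it is majorised term
  -- by term. The two sides differ in length because the induction shortens only the one of `f`.
  rectangle-∣∣ : ∀ {f F g G} → (∀ k → ∣ f k ∣ ≤ F k) → (∀ k → ∣ g k ∣ ≤ G k) → ∀ n N → n ℕ.≤ N →
    ∣ partialSum f n * partialSum g N - triangleSum f g n ∣
    ≤ partialSum F n * partialSum G N - triangleSum F G n
  rectangle-∣∣ {f} {F} {g} {G} hf hg zero N n≤N = subst₂ _≤_
    (cong ∣_∣ (factor (f 0) (partialSum g N) (g 0))) (factor (F 0) (partialSum G N) (G 0))
    (∣*∣-mono (f 0) (partialSum g N - g 0) (hf 0) (partialSum-∣∣ hg (ℕ.≤⇒≤′ n≤N)))
    where
    factor : ∀ a b c → a * (b - c) ≡ a * b - a * c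
    factor = solve 3 (λ a b c → a :* (b :- c) := a :* b :- a :* c) refl
  rectangle-∣∣ {f} {F} {g} {G} hf hg (suc n) N n≤N = subst₂ _≤_
    (cong ∣_∣ (sym (rectangle-head f g n N))) (sym (rectangle-head F G n N))
    (ℚ.≤-trans (ℚ.∣p+q∣≤∣p∣+∣q∣ (f 0 * (partialSum g N - partialSum g (suc n)))
        (partialSum (f ∘ suc) n * partialSum g N - triangleSum (f ∘ suc) g n))
      (ℚ.+-mono-≤ (∣*∣-mono (f 0) (partialSum g N - partialSum g (suc n)) (hf 0) (partialSum-∣∣ hg (ℕ.≤⇒≤′ n≤N)))
        (rectangle-∣∣ (hf ∘ suc) hg n N (ℕ.≤-trans (ℕ.n≤1+n n) n≤N))))

  cauchyProduct-≥0 : ∀ {f g} → (∀ k → 0ℚ ≤ f k) → (∀ k → 0ℚ ≤ g k) → ∀ n → 0ℚ ≤ cauchyProduct f g n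
  cauchyProduct-≥0 hf hg zero    = 0≤* (hf 0) (hg 0)
  cauchyProduct-≥0 hf hg (suc n) = ℚ.+-mono-≤ (0≤* (hf 0) (hg (suc n))) (cauchyProduct-≥0 (hf ∘ suc) hg n)

  -- The rectangle i ≤ m, j ≤ n lies in the triangle i + j ≤ m + n, and all terms are nonnegative.
  rectangle≤triangle : ∀ {f g} → (∀ k → 0ℚ ≤ f k) → (∀ k → 0ℚ ≤ g k) → ∀ m n →
    partialSum f m * partialSum g n ≤ triangleSum f g (m ℕ.+ n)
  rectangle≤triangle {f} {g} hf hg zero    zero    = ℚ.≤-refl
  rectangle≤triangle {f} {g} hf hg zero    (suc n) = subst (f 0 * partialSum g (suc n) ≤_)
    (sym (triangleSum-head f g n))
    (≤-+ (f 0 * partialSum g (suc n)) (partialSum-≥0 (cauchyProduct-≥0 (hf ∘ suc) hg) n))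
  rectangle≤triangle {f} {g} hf hg (suc m) n = begin
    partialSum f (suc m) * partialSum g n
      ≡⟨ trans (cong (_* partialSum g n) (partialSum-head f m))
           (ℚ.*-distribʳ-+ (partialSum g n) (f 0) (partialSum (f ∘ suc) m)) ⟩
    f 0 * partialSum g n + partialSum (f ∘ suc) m * partialSum g n
      ≤⟨ ℚ.+-mono-≤ (ℚ.*-monoˡ-≤-nonNeg (f 0) {{ℚ.nonNegative (hf 0)}} (partialSum-grows hg (suc m) n))
           (rectangle≤triangle (hf ∘ suc) hg m n) ⟩
    f 0 * partialSum g (suc m ℕ.+ n) + triangleSum (f ∘ suc) g (m ℕ.+ n)
      ≡⟨ sym (triangleSum-head f g (m ℕ.+ n)) ⟩
    triangleSum f g (suc m ℕ.+ n) ∎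

  -- Bounds on the partial sums of e⁻ˣ.

  triangleSum-expTerm : ∀ a b n → triangleSum (expTerm a) (expTerm b) n ≡ expSum (a + b) n
  triangleSum-expTerm a b n = trans (partialSum-cong (expTerm-+ a b) n) (sym (expSum≡partialSum (a + b) n))

  expSum-0 : ∀ n → expSum 0ℚ n ≡ 1ℚ
  expSum-0 zero    = refl
  expSum-0 (suc n) = trans (cong (_+ expTerm 0ℚ (suc n)) (expSum-0 n))
    (solve 2 (λ t r → con 1ℚ :+ t :* (con 0ℚ :* r) := con 1ℚ) refl (expTerm 0ℚ n) (recip n))

  -- The triangle for x and -x sums to `expSum 0ℚ n`, which is 1. What the rectangle has beyond it
  -- is majorised by the same region for x and x, and that region lies between the triangles of size
  -- n and 2n for e²ˣ.
  expSum-inverse : ∀ x → 0ℚ ≤ x → ∀ n →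
    ∣ expSum x n * expSum (- x) n - 1ℚ ∣ ≤ expSum (x + x) (n ℕ.+ n) - expSum (x + x) n
  expSum-inverse x 0≤x n = begin
    ∣ expSum x n * expSum (- x) n - 1ℚ ∣
      ≡⟨ cong ∣_∣ (cong₂ _-_ (cong₂ _*_ (expSum≡partialSum x n) (expSum≡partialSum (- x) n))
           (sym (trans (triangleSum-expTerm x (- x) n)
             (trans (cong (λ y → expSum y n) (ℚ.+-inverseʳ x)) (expSum-0 n))))) ⟩
    ∣ partialSum t n * partialSum s n - triangleSum t s n ∣
      ≤⟨ rectangle-∣∣ (λ k → ℚ.≤-reflexive (ℚ.0≤p⇒∣p∣≡p (expTerm-≥0 0≤x k)))
           (expTerm-mono (ℚ.≤-reflexive (trans (ℚ.∣-p∣≡∣p∣ x) (ℚ.0≤p⇒∣p∣≡p 0≤x)))) n n ℕ.≤-refl ⟩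
    partialSum t n * partialSum t n - triangleSum t t n
      ≤⟨ ℚ.+-monoˡ-≤ (- triangleSum t t n) (rectangle≤triangle (expTerm-≥0 0≤x) (expTerm-≥0 0≤x) n n) ⟩
    triangleSum t t (n ℕ.+ n) - triangleSum t t n
      ≡⟨ cong₂ _-_ (triangleSum-expTerm x x (n ℕ.+ n)) (triangleSum-expTerm x x n) ⟩
    expSum (x + x) (n ℕ.+ n) - expSum (x + x) n ∎
    where
    t s : ℕ → ℚ
    t = expTerm x
    s = expTerm (- x)

  expSum-lower : ∀ x → 1ℚ ≤ x → ∀ n → 3 ℕ.≤ n → ℤ.+ 8 / 3 ≤ expSum x n
  expSum-lower x 1≤x n 3≤n = begin
    -- This evaluates to 1 + 1 + 1/2 + 1/6 = 8/3; the absolute values fit `expTerm-mono`.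
    partialSum (λ k → ∣ expTerm 1ℚ k ∣) 3    ≤⟨ partialSum-mono (expTerm-mono {1ℚ} 1≤x) 3 ⟩
    partialSum (expTerm x) 3                 ≤⟨ partialSum-grows (expTerm-≥0 0≤x) (n ℕ.∸ 3) 3 ⟩
    partialSum (expTerm x) (n ℕ.∸ 3 ℕ.+ 3)   ≡⟨ cong (partialSum (expTerm x)) (ℕ.m∸n+n≡m 3≤n) ⟩
    partialSum (expTerm x) n                 ≡⟨ sym (expSum≡partialSum x n) ⟩
    expSum x n                               ∎
    where
    0≤x : 0ℚ ≤ x
    0≤x = ℚ.≤-trans (ℚ.nonNegative⁻¹ 1ℚ) 1≤x

  inverse-bounds : ∀ {a b} → ℤ.+ 8 / 3 ≤ a → ∣ a * b - 1ℚ ∣ ≤ η → 0ℚ ≤ b × b ≤ ℤ.+ 3 / 8 + η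
  inverse-bounds {a} {b} 8/3≤a h = 0≤b , (begin
    b                                     ≡⟨ solve 1 (λ b → b := con (ℤ.+ 3 / 8) :* (con (ℤ.+ 8 / 3) :* b)) refl b ⟩
    ℤ.+ 3 / 8 * (ℤ.+ 8 / 3 * b)           ≤⟨ ℚ.*-monoˡ-≤-nonNeg (ℤ.+ 3 / 8) (ℚ.*-monoʳ-≤-nonNeg b {{ℚ.nonNegative 0≤b}} 8/3≤a) ⟩
    ℤ.+ 3 / 8 * (a * b)                   ≤⟨ ℚ.*-monoˡ-≤-nonNeg (ℤ.+ 3 / 8) (∣-∣≤⁻ {a * b} {1ℚ} h) ⟩
    -- 5/512 is 5/8 · `η`, the difference of the two sides.
    ℤ.+ 3 / 8 * (1ℚ + η)                  ≤⟨ ≤-+ (ℤ.+ 3 / 8 * (1ℚ + η)) (ℚ.nonNegative⁻¹ (ℤ.+ 5 / 512)) ⟩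
    ℤ.+ 3 / 8 + η                         ∎)
    where
    0<a : 0ℚ < a
    0<a = ℚ.<-≤-trans (ℚ.positive⁻¹ (ℤ.+ 8 / 3)) 8/3≤a
    0<ab : 0ℚ < a * b
    0<ab = ℚ.<-≤-trans (ℚ.positive⁻¹ (1ℚ - η)) (begin
      1ℚ - η               ≤⟨ ℚ.+-monoˡ-≤ (- η) (∣-∣≤⁻ {1ℚ} {a * b} (subst (_≤ η) (∣-∣-swap (a * b) 1ℚ) h)) ⟩
      a * b + η - η        ≡⟨ solve 2 (λ x y → x :+ y :- y := x) refl (a * b) η ⟩
      a * b                ∎)
    0≤b : 0ℚ ≤ b
    0≤b = ℚ.<⇒≤ (ℚ.*-cancelˡ-<-nonNeg a {{ℚ.nonNegative (ℚ.<⇒≤ 0<a)}} (subst (_< a * b) (sym (ℚ.*-zeroʳ a)) 0<ab))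

  -- The error in `expSum-inverse` is a difference of two late partial sums of e²ˣ, each within half
  -- of `η` of the partial sum at L.
  expSum-neg-bounds : ∀ x → 1ℚ ≤ x → ∃ λ N → ∀ n → N ℕ.≤ n →
    0ℚ ≤ expSum (- x) n × expSum (- x) n ≤ ℤ.+ 3 / 8 + η
  expSum-neg-bounds x 1≤x =
    let L , small = remainder-small (x + x) (½ * η) (ℚ.positive⁻¹ (½ * η))
    in L ℕ.⊔ 3 , λ n hn →
      let L≤n = ℕ.m⊔n≤o⇒m≤o L 3 hn in
      inverse-bounds (expSum-lower x 1≤x n (ℕ.m⊔n≤o⇒n≤o L 3 hn)) (begin
        ∣ expSum x n * expSum (- x) n - 1ℚ ∣              ≤⟨ expSum-inverse x 0≤x n ⟩
        expSum (x + x) (n ℕ.+ n) - expSum (x + x) n       ≤⟨ ≤∣∣ (expSum (x + x) (n ℕ.+ n) - expSum (x + x) n) ⟩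
        ∣ expSum (x + x) (n ℕ.+ n) - expSum (x + x) n ∣   ≤⟨ triangle {expSum (x + x) (n ℕ.+ n)} {expSum (x + x) L} {expSum (x + x) n}
                                                               (small (x + x) ∣2x∣≤ (n ℕ.+ n) (ℕ.≤-trans L≤n (ℕ.m≤m+n n n)))
                                                               (subst (_≤ ½ * η) (∣-∣-swap (expSum (x + x) n) (expSum (x + x) L))
                                                                 (small (x + x) ∣2x∣≤ n L≤n)) ⟩
        ½ * η + ½ * η                                     ≡⟨ halves η ⟩
        η                                                 ∎)
    where
    0≤x : 0ℚ ≤ x
    0≤x = ℚ.≤-trans (ℚ.nonNegative⁻¹ 1ℚ) 1≤x
    ∣2x∣≤ : ∣ x + x ∣ ≤ x + x
    ∣2x∣≤ = ℚ.≤-reflexive (ℚ.0≤p⇒∣p∣≡p (ℚ.+-mono-≤ 0≤x 0≤x))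

 -- The numerical contradiction and the passage to square roots.

 -- 9/64 = 1/8 + η and 34/64 = (3/8 + η) + (1/8 + η).
 InRange : ℚ → Set
 InRange z = - (ℤ.+ 9 / 64) ≤ z × z ≤ ℤ.+ 34 / 64

 abstract

  inRange : ∀ {y z} → 0ℚ ≤ y × y ≤ ℤ.+ 3 / 8 + η → ∣ y - z ∣ ≤ ℤ.+ 1 / 8 + η → InRange z
  inRange {y} {z} (0≤y , y≤) h =
      ≤-diff (ℚ.+-mono-≤ 0≤y (0≤- (∣-∣≤⁻ {y} {z} h)))
        (solve 2 (λ y z → z :- con (- (ℤ.+ 9 / 64)) := y :+ (z :+ con (ℤ.+ 1 / 8 + η) :- y)) refl y z)
    , ℚ.≤-trans (∣-∣≤⁻ {z} {y} (subst (_≤ ℤ.+ 1 / 8 + η) (∣-∣-swap y z) h)) (ℚ.+-monoˡ-≤ (ℤ.+ 1 / 8 + η) y≤)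

  -- 43/64 = 34/64 + 9/64 is the length of the interval.
  inRange-∣∣ : ∀ {y z} → InRange y → InRange z → ∣ y - z ∣ ≤ ℤ.+ 43 / 64
  inRange-∣∣ {y} {z} hy hz = ∣-∣≤ {y} {z} (below hy hz) (below hz hy)
    where
    below : ∀ {y z} → InRange y → InRange z → y ≤ z + ℤ.+ 43 / 64
    below {y} {z} (_ , y≤) (≤z , _) = ≤-diff (ℚ.+-mono-≤ (0≤- y≤) (0≤- ≤z))
      (solve 2 (λ y z → z :+ con (ℤ.+ 43 / 64) :- y
        := (con (ℤ.+ 34 / 64) :- y) :+ (z :- con (- (ℤ.+ 9 / 64)))) refl y z)

  -- p(0) ≥ 1 - 9/64 = 55/64 and p(1) ≤ 34/64 force a drop of at least 21/64, while `drop-bound`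
  -- allows only 4/9 · 43/64 < 20/64.
  no-approximant : ∀ p d → length p ℕ.≤ suc d → ∣ 1ℚ - evalℚ p 0ℚ ∣ ≤ ℤ.+ 1 / 8 + η →
    InRange (evalℚ p 1ℚ) → (∀ i → i ℕ.< d → InRange (evalℚ p (node (suc i)))) → ⊥
  no-approximant p d len h₀ h₁ h = ℚ.<-irrefl {0ℚ} refl (begin-strict
    0ℚ
      <⟨ ℚ.positive⁻¹ ((ℤ.+ 55 / 64 - ℤ.+ 34 / 64) - ℤ.+ 4 / 9 * (ℤ.+ 43 / 64)) ⟩
    (ℤ.+ 55 / 64 - ℤ.+ 34 / 64) - ℤ.+ 4 / 9 * (ℤ.+ 43 / 64)
      ≤⟨ ≤-diff (ℚ.+-mono-≤ (ℚ.+-mono-≤ (0≤- (∣-∣≤⁻ {1ℚ} {z₀} h₀)) (0≤- (proj₂ h₁))) (0≤- drop))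
           (solve 2 (λ a b → con 0ℚ :- ((con (ℤ.+ 55 / 64) :- con (ℤ.+ 34 / 64)) :- con (ℤ.+ 4 / 9 * (ℤ.+ 43 / 64)))
             := ((a :+ con (ℤ.+ 1 / 8 + η) :- con 1ℚ) :+ (con (ℤ.+ 34 / 64) :- b)) :+ (con (ℤ.+ 4 / 9 * (ℤ.+ 43 / 64)) :- (a :- b)))
             refl z₀ z₁) ⟩
    0ℚ ∎)
    where
    z₀ z₁ : ℚ
    z₀ = evalℚ p 0ℚ
    z₁ = evalℚ p 1ℚ
    drop : z₀ - z₁ ≤ ℤ.+ 4 / 9 * (ℤ.+ 43 / 64)
    drop = drop-bound p d (ℤ.+ 43 / 64) len (ℚ.nonNegative⁻¹ (ℤ.+ 43 / 64))
      (λ i i<d → inRange-∣∣ {evalℚ p (node (suc i))} {z₁} (h i i<d) h₁)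

  node-mono : ∀ {i j} → i ℕ.≤ j → node i ≤ node j
  node-mono {i} {j} h = ℚ.*-monoˡ-≤-nonNeg (nat 9)
    (*-mono (nat-≥0 j) (nat-≥0 i) (nat-mono h) (nat-mono h))

  -- The hypothesis reads q ≤ (3d)² + (3ε)², so the root is at most 3d + 3ε.
  sqrtApprox-node : ∀ q n d ε → 0ℚ < ε → q ≤ node d + nat 3 * ε * (nat 3 * ε) →
    ℤ.+ 1 / 3 * sqrtApprox q n ≤ nat d + ε
  sqrtApprox-node q n d ε 0<ε h = begin
    ℤ.+ 1 / 3 * sqrtApprox q n
      ≤⟨ ℚ.*-monoˡ-≤-nonNeg (ℤ.+ 1 / 3) (root-step {sqrtApprox q n} {nat 3 * nat d} {node d} {nat 3 * ε}
           (0≤* (nat-≥0 3) (nat-≥0 d)) 0≤3ε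
           (ℚ.≤-trans (sqrtApprox-lower q n)
             (ℚ.⊔-lub h (ℚ.+-mono-≤ (0≤* (nat-≥0 9) (0≤* (nat-≥0 d) (nat-≥0 d))) (0≤* 0≤3ε 0≤3ε))))
           (ℚ.≤-reflexive (solve 1 (λ d → con (nat 9) :* (d :* d) := (con (nat 3) :* d) :* (con (nat 3) :* d)) refl (nat d)))) ⟩
    ℤ.+ 1 / 3 * (nat 3 * nat d + nat 3 * ε)
      ≡⟨ solve 2 (λ d e → con (ℤ.+ 1 / 3) :* (con (nat 3) :* d :+ con (nat 3) :* e) := d :+ e) refl (nat d) ε ⟩
    nat d + ε ∎
    where
    0≤3ε : 0ℚ ≤ nat 3 * ε
    0≤3ε = 0≤* (nat-≥0 3) (ℚ.<⇒≤ 0<ε)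

open RationalArguments

open import Defs
open import Data.Integer.Base using (+_)
open import Data.Rational.Base using (_/_)

-- Late rational approximants of real polynomials.

Eventually : (ℕ → Set) → Set
Eventually P = ∃ λ N → ∀ n → N ℕ.≤ n → P n

eventually-× : ∀ {P Q} → Eventually P → Eventually Q → Eventually (λ n → P n × Q n)
eventually-× (M , p) (N , q) = M ℕ.⊔ N , λ n h → p n (ℕ.m⊔n≤o⇒m≤o M N h) , q n (ℕ.m⊔n≤o⇒n≤o M N h)

eventually-map : ∀ {P Q : ℕ → Set} → (∀ n → P n → Q n) → Eventually P → Eventually Q
eventually-map f (N , p) = N , λ n h → f n (p n h)

eventually-∀< : ∀ {P : ℕ → ℕ → Set} d → (∀ i → i ℕ.< d → Eventually (P i)) →
  Eventually (λ n → ∀ i → i ℕ.< d → P i n)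
eventually-∀< zero    h = 0 , λ _ _ _ ()
eventually-∀< {P} (suc d) h = eventually-map (λ n (p , q) i i<1+d → split n p q i (ℕ.m<1+n⇒m<n∨m≡n i<1+d))
  (eventually-× (eventually-∀< d (λ i i<d → h i (ℕ.m≤n⇒m≤1+n i<d))) (h d ℕ.≤-refl))
  where
  split : ∀ n → (∀ i → i ℕ.< d → P i n) → P d n → ∀ i → i ℕ.< d ⊎ i ≡ d → P i n
  split n p q i (inj₁ i<d)  = p i i<d
  split n p q i (inj₂ refl) = q

-- A coefficient that vanishes as a real may have nonzero approximants, so they are cut off to
-- obtain a rational polynomial with a genuine bound on its length.
truncation : Polynomial → ℕ → ℕ → List ℚ
truncation p m n = take m (map (λ a → seq a n) p)

length-truncation : ∀ p m n → length (truncation p m n) ℕ.≤ m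
length-truncation p m n = subst (ℕ._≤ m) (sym (length-take m (map (λ a → seq a n) p))) (ℕ.m⊓n≤m m _)

-- Induction along Horner's scheme. Each step multiplies the error of the tail by q, so the tail is
-- given a tolerance divided by a natural number above |q|.
eval-truncation : ∀ p m q → (∀ k → m ℕ.≤ k → coeff p k ≃ 0ℝ) → ∀ ε → 0ℚ ℚ.< ε →
  Eventually (λ n → ℚ.∣ seq (eval p (fromℚ q)) n ℚ.- evalℚ (truncation p m n) q ∣ ℚ.≤ ε)
eval-truncation []      zero    q h ε 0<ε = 0 , λ _ _ → ℚ.<⇒≤ 0<ε
eval-truncation []      (suc m) q h ε 0<ε = 0 , λ _ _ → ℚ.<⇒≤ 0<ε
eval-truncation (a ∷ p) m q h ε 0<ε = go m h
  where
  open +-*-Solver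
  k : ℕ
  k = proj₁ (bound ℚ.∣ q ∣)
  ∣q∣≤ : ℚ.∣ q ∣ ℚ.≤ nat (suc k)
  ∣q∣≤ = ℚ.≤-trans (proj₂ (bound ℚ.∣ q ∣)) (nat-mono (ℕ.n≤1+n k))
  scale : ∀ {y z e} → ℚ.∣ y ℚ.- z ∣ ℚ.≤ e ℚ.* recip k → ℚ.∣ q ℚ.* (y ℚ.- z) ∣ ℚ.≤ e
  scale {y} {z} = *-small k q (y ℚ.- z) ∣q∣≤
  go : ∀ m → (∀ k → m ℕ.≤ k → coeff (a ∷ p) k ≃ 0ℝ) →
    Eventually (λ n → ℚ.∣ seq (eval (a ∷ p) (fromℚ q)) n ℚ.- evalℚ (truncation (a ∷ p) m n) q ∣ ℚ.≤ ε)
  -- Nothing is kept: half of ε covers the head, which vanishes as a real, and half covers the tail.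
  go zero h = eventually-map
    (λ n (ha , hp) → subst₂ ℚ._≤_ (cong ℚ.∣_∣ (rearrange (seq a n) (seq (eval p (fromℚ q)) n))) (halves ε)
      (ℚ.≤-trans (ℚ.∣p+q∣≤∣p∣+∣q∣ (seq a n ℚ.- 0ℚ) (q ℚ.* (seq (eval p (fromℚ q)) n ℚ.- 0ℚ)))
        (ℚ.+-mono-≤ ha (scale {seq (eval p (fromℚ q)) n} {0ℚ} hp))))
    (eventually-× (_≃_.close (h 0 ℕ.z≤n) (½ ℚ.* ε) (0<* 0<½ 0<ε))
      (eval-truncation p 0 q (λ k _ → h (suc k) ℕ.z≤n) (½ ℚ.* ε ℚ.* recip k)
        (0<* (0<* 0<½ 0<ε) (0<recip k))))
    where
    rearrange : ∀ a y → (a ℚ.- 0ℚ) ℚ.+ q ℚ.* (y ℚ.- 0ℚ) ≡ (a ℚ.+ q ℚ.* y) ℚ.- 0ℚ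
    rearrange a y = solve 3 (λ a q y → (a :- con 0ℚ) :+ q :* (y :- con 0ℚ) := (a :+ q :* y) :- con 0ℚ) refl a q y
  go (suc m) h = eventually-map
    (λ n hp → subst (ℚ._≤ ε)
      (cong ℚ.∣_∣ (rearrange (seq a n) (seq (eval p (fromℚ q)) n) (evalℚ (truncation p m n) q)))
      (scale {seq (eval p (fromℚ q)) n} {evalℚ (truncation p m n) q} hp))
    (eval-truncation p m q (λ k m≤k → h (suc k) (ℕ.s≤s m≤k)) (ε ℚ.* recip k) (0<* 0<ε (0<recip k)))
    where
    rearrange : ∀ a y z → q ℚ.* (y ℚ.- z) ≡ (a ℚ.+ q ℚ.* y) ℚ.- (a ℚ.+ q ℚ.* z)
    rearrange a y z = solve 4 (λ a q y z → q :* (y :- z) := (a :+ q :* y) :- (a :+ q :* z)) refl a q y z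

-- The degree bound.

module _ (b δ : ℝ) (5≤b : fromℕ 5 ≤ b) (δ≤ : δ ≤ fromℚ (+ 1 / 8)) (p : Polynomial)
  (approx : UniformlyApproximates (λ x → exp (- x)) (eval p) 0ℝ b δ)
  (d : ℕ) (deg : DegreeAtMost p d) where

  values : ℕ → ℚ → ℚ
  values n = evalℚ (truncation p (suc d) n)

  values-close : ∀ q → 0ℚ ℚ.≤ q → fromℚ q ≤ b →
    Eventually (λ n → ℚ.∣ expSum (ℚ.- q) n ℚ.- values n q ∣ ℚ.≤ + 1 / 8 ℚ.+ η)
  values-close q 0≤q q≤b = eventually-map
    (λ n ((h₁ , h₂) , h₃) → triangle {expSum (ℚ.- q) n} {seq (eval p (fromℚ q)) n} {values n q}
      (ℚ.≤-trans h₁ (ℚ.+-monoˡ-≤ ε h₂)) h₃)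
    (eventually-× (eventually-×
      (_≤_.below (approx (fromℚ q) (mk≤ λ ε 0<ε → 0 , λ n _ → ℚ.≤-trans 0≤q (≤-+ q (ℚ.<⇒≤ 0<ε))) q≤b) ε 0<ε)
      (_≤_.below δ≤ ε 0<ε))
      -- `d < k` unfolds to `suc d ≤ k`, so `deg` fits the truncation to d + 1 coefficients.
      (eval-truncation p (suc d) q deg ε′ 0<ε′))
    where
    -- Two real inequalities at 1/256 each and the truncation at 2/256 add up to `η`.
    ε ε′ : ℚ
    ε = + 1 / 256
    ε′ = + 2 / 256
    0<ε : 0ℚ ℚ.< ε
    0<ε = ℚ.positive⁻¹ ε
    0<ε′ : 0ℚ ℚ.< ε′
    0<ε′ = ℚ.positive⁻¹ ε′

  values-inRange : ∀ q → 1ℚ ℚ.≤ q → fromℚ q ≤ b → Eventually (λ n → InRange (values n q))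
  values-inRange q 1≤q q≤b = eventually-map
    (λ n (h₁ , h₂) → inRange {expSum (ℚ.- q) n} {values n q} h₁ h₂)
    (eventually-× (expSum-neg-bounds q 1≤q) (values-close q (ℚ.≤-trans (ℚ.nonNegative⁻¹ 1ℚ) 1≤q) q≤b))

  fromℚ-≤ : ∀ {q r} → q ℚ.≤ r → fromℚ r ≤ b → fromℚ q ≤ b
  fromℚ-≤ q≤r r≤b = mk≤ λ ε 0<ε → eventually-map (λ n → ℚ.≤-trans q≤r) (_≤_.below r≤b ε 0<ε)

  -- If the last node is in [0,b], so are all nodes, and 0 and 1 are because b ≥ 5. These are
  -- finitely many estimates, so one index N serves them all and yields a rational polynomial
  -- excluded by `no-approximant`.
  node≰b : fromℚ (node d) ≤ b → ⊥
  node≰b node≤b =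
    let N , h = eventually-× (values-close 0ℚ ℚ.≤-refl (fromℚ-≤ (nat-≥0 5) 5≤b))
                  (eventually-× (values-inRange 1ℚ ℚ.≤-refl (fromℚ-≤ (nat-mono {1} {5} (ℕ.s≤s ℕ.z≤n)) 5≤b))
                    (eventually-∀< d λ i i<d → values-inRange (node (suc i)) (1≤node i)
                      (fromℚ-≤ (node-mono i<d) node≤b)))
        h₀ , h₁ , h₂ = h N ℕ.≤-refl
    in no-approximant (truncation p (suc d) N) d (length-truncation p (suc d) N)
         (subst (λ y → ℚ.∣ y ℚ.- values N 0ℚ ∣ ℚ.≤ + 1 / 8 ℚ.+ η) (expSum-0 N) h₀) h₁ h₂

  -- The order of the reals is undecidable, so one late approximant of b is compared with 9d² + c,
  -- where c = (3ε)²/2 is also the tolerance of later approximants. If it is not larger, they stay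
  -- below 9d² + 2c; otherwise they are all at least 9d², and `node≰b` applies.
  degree-bound : fromℚ (+ 1 / 3) * √ b ≤ fromℕ d
  degree-bound = mk≤ λ ε 0<ε →
    let e = nat 3 ℚ.* ε
        0<3ε = 0<* (ℚ.positive⁻¹ (nat 3)) 0<ε
        0<e = 0<* 0<½ (0<* 0<3ε 0<3ε)
        N , h = cauchy b (½ ℚ.* (e ℚ.* e)) 0<e
    in N , λ n N≤n → sqrtApprox-node (seq b n) n d ε 0<ε
         (decide N (½ ℚ.* (e ℚ.* e)) h (seq b N ℚ.≤? node d ℚ.+ ½ ℚ.* (e ℚ.* e)) (halves (e ℚ.* e)) n N≤n)
    where
    decide : ∀ N c → (∀ m n → N ℕ.≤ m → N ℕ.≤ n → ℚ.∣ seq b m ℚ.- seq b n ∣ ℚ.≤ c) →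
      Dec (seq b N ℚ.≤ node d ℚ.+ c) → ∀ {c₂} → c ℚ.+ c ≡ c₂ → ∀ n → N ℕ.≤ n → seq b n ℚ.≤ node d ℚ.+ c₂
    decide N c h (yes b≤) refl n N≤n = ℚ.≤-trans (∣-∣≤⁻ {seq b n} {seq b N} (h n N N≤n ℕ.≤-refl))
      (subst (seq b N ℚ.+ c ℚ.≤_) (ℚ.+-assoc (node d) c c) (ℚ.+-monoˡ-≤ c b≤))
    decide N c h (no b≰) refl n N≤n = ⊥-elim (node≰b (mk≤ λ ε 0<ε → N , λ m N≤m →
      ℚ.≤-trans (+-cancelʳ-≤ c
        (ℚ.≤-trans (ℚ.<⇒≤ (ℚ.≰⇒> b≰)) (∣-∣≤⁻ {seq b N} {seq b m} (h N m ℕ.≤-refl N≤m))))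
        (≤-+ (seq b m) (ℚ.<⇒≤ 0<ε))))

theorem3p7 : (b δ : ℝ) → fromℕ 5 ≤ b → 0ℝ < δ → δ ≤ fromℚ (+ 1 / 8) →
    (p : Polynomial) →
    UniformlyApproximates (λ x → exp (- x)) (eval p) 0ℝ b δ →
    DegreeAtLeast p (fromℚ (+ 1 / 3) * √ b)
theorem3p7 b δ 5≤b _ δ≤ p approx = degree-bound b δ 5≤b δ≤ p approx
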